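{- Let $k\ge1$ and let $(H,\psi)$ be a rainbow pre-coloring tuple with colors in $[k]$. For every $\varepsilon>0$ there exists $\delta>0$ such that if a graph system $\mathcal{G} = (G_1, \ldots, G_k)$ on $n$ vertices has at most $\delta n^{|V(H)|}$ rainbow copies of $(H, \psi)$, then one can delete at most $\varepsilon n^2$ edges in total from the graphs $G_1,\dots,G_k$ to make $\mathcal{G}$ rainbow $(H, \psi)$-free.
   Context: Multigraphs have no loops. For a multigraph $H$ and distinct $u,v$, $E_{uv}$ is the set of edges between $u$ and $v$. A rainbow pre-coloring of $H$ is an injective map $\psi:X\to[k]$ with $X\subseteq E(H)$; $(H,\psi)$ is a rainbow pre-coloring tuple. A graph system of order $k$ on $V$ is a tuple $(G_1,\dots,G_k)$ of simple graphs on the common vertex set $V$. A rainbow copy of $(H,\psi)$ in $\mathcal{G}$ is a multigraph $H'$ with $V(H')\subseteq V$ together with an injective map $\psi':E(H')\to[k]$ such that for some isomorphism $\phi:H\to H'$, $\psi'\circ\phi$ extends $\psi$, and $e\in E(G_{\psi'(e)})$ for every $e\in E(H')$. $\mathcal{G}$ is rainbow $(H,\psi)$-free if it has no rainbow copy of $(H,\psi)$. -}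

module Defs where

open import Data.Nat using (ℕ; zero; suc; _+_; _∸_; _^_; _≤_)
open import Data.Nat.Properties using (≤-refl)
open import Data.Fin using (Fin; _<_)
open import Data.Fin.Properties using (_≟_; all?; any?)
open import Data.Bool using (Bool; true; false)
import Data.Bool.Properties as BoolP
open import Data.Maybe using (Maybe; just; nothing)
open import Data.Product using (Σ; _×_; _,_; proj₁; proj₂; ∃)
open import Data.List using (List; []; _∷_; length; filter; cartesianProduct; map; concatMap; allFin)
open import Data.Vec using (Vec; lookup)
import Data.Vec as Vec
open import Relation.Nullary using (Dec; yes; no; ¬_)
open import Relation.Nullary.Decidable using (_×-dec_; _→-dec_)
open import Relation.Binary.PropositionalEquality using (_≡_; refl)

record SimpleGraph (n : ℕ) : Set where
  field
    adj   : Fin n → Fin n → Bool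
    sym   : ∀ u v → adj u v ≡ adj v u
    loopless : ∀ v → adj v v ≡ false
open SimpleGraph public

GraphSystem : ℕ → ℕ → Set
GraphSystem k n = Fin k → SimpleGraph n

edgeCount : ∀ {n} → SimpleGraph n → ℕ
edgeCount {n} G =
  length (filter (λ p → (proj₁ p Data.Fin.<? proj₂ p) ×-dec (adj G (proj₁ p) (proj₂ p) BoolP.≟ true))
                 (cartesianProduct (allFin n) (allFin n)))

_⊆G_ : ∀ {n} → SimpleGraph n → SimpleGraph n → Set
G' ⊆G G = ∀ u v → adj G' u v ≡ true → adj G u v ≡ true

sumFin : ∀ {k} → (Fin k → ℕ) → ℕ
sumFin {zero}  f = 0
sumFin {suc k} f = f Fin.zero + sumFin (λ i → f (Fin.suc i))

-- Total number of edges deleted when passing from 𝒢 to 𝒢' (𝒢' ⊆ 𝒢).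
deletedEdges : ∀ {k n} → GraphSystem k n → GraphSystem k n → ℕ
deletedEdges 𝒢 𝒢' = sumFin (λ i → edgeCount (𝒢 i) ∸ edgeCount (𝒢' i))

record Multigraph : Set where
  field
    nV   : ℕ
    nE   : ℕ
    ends : Fin nE → Fin nV × Fin nV
    noLoop : ∀ e → ¬ (proj₁ (ends e) ≡ proj₂ (ends e))
open Multigraph public

-- Rainbow pre-coloring with colors in [k] = Fin k: a partial injective map
-- ψ : X → [k], X ⊆ E(H) being the set of edges where ψ is defined.
record RainbowPrecoloring (k : ℕ) (H : Multigraph) : Set where
  field
    ψ    : Fin (nE H) → Maybe (Fin k)
    inj  : ∀ e f c → ψ e ≡ just c → ψ f ≡ just c → e ≡ f
open RainbowPrecoloring public

-- Labelled rainbow copies: an injective vertex map φ : V(H) → V together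
-- with an injective colouring c : E(H) → [k] extending ψ such that the
-- image of every edge e lies in G_{c(e)}.  (Vectors are used so that
-- copies can be enumerated.)

Copy : (k n : ℕ) (H : Multigraph) → Set
Copy k n H = Vec (Fin n) (nV H) × Vec (Fin k) (nE H)

IsRainbowCopy : ∀ {k n} (H : Multigraph) → RainbowPrecoloring k H →
                GraphSystem k n → Copy k n H → Set
IsRainbowCopy H ψ 𝒢 (φ , c) =
    (∀ a b → lookup φ a ≡ lookup φ b → a ≡ b)
  × (∀ e f → lookup c e ≡ lookup c f → e ≡ f)
  × (∀ e j → RainbowPrecoloring.ψ ψ e ≡ just j → lookup c e ≡ j)
  × (∀ e → adj (𝒢 (lookup c e)) (lookup φ (proj₁ (ends H e))) (lookup φ (proj₂ (ends H e))) ≡ true)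

RainbowFree : ∀ {k n} (H : Multigraph) → RainbowPrecoloring k H → GraphSystem k n → Set
RainbowFree H ψ 𝒢 = ∀ x → ¬ IsRainbowCopy H ψ 𝒢 x

allVecs : ∀ {A : Set} → List A → (l : ℕ) → List (Vec A l)
allVecs xs zero    = Vec.[] ∷ []
allVecs xs (suc l) = concatMap (λ x → map (x Vec.∷_) (allVecs xs l)) xs

allCopies : (k n : ℕ) (H : Multigraph) → List (Copy k n H)
allCopies k n H = cartesianProduct (allVecs (allFin n) (nV H)) (allVecs (allFin k) (nE H))

isRainbowCopy? : ∀ {k n} (H : Multigraph) (ψ : RainbowPrecoloring k H)
                 (𝒢 : GraphSystem k n) (x : Copy k n H) → Dec (IsRainbowCopy H ψ 𝒢 x)
isRainbowCopy? H ψ 𝒢 (φ , c) =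
      all? (λ a → all? (λ b → (lookup φ a ≟ lookup φ b) →-dec (a ≟ b)))
  ×-dec all? (λ e → all? (λ f → (lookup c e ≟ lookup c f) →-dec (e ≟ f)))
  ×-dec all? (λ e → all? (λ j → (maybeEq (RainbowPrecoloring.ψ ψ e) j) →-dec (lookup c e ≟ j)))
  ×-dec all? (λ e → adj (𝒢 (lookup c e)) (lookup φ (proj₁ (ends H e))) (lookup φ (proj₂ (ends H e))) BoolP.≟ true)
  where
  maybeEq : ∀ {k} (m : Maybe (Fin k)) (j : Fin k) → Dec (m ≡ just j)
  maybeEq nothing  j = no (λ ())
  maybeEq (just i) j with i ≟ j
  ... | yes refl = yes refl
  ... | no i≢j = no (λ { refl → i≢j refl })

rainbowCopyCount : ∀ {k n} (H : Multigraph) → RainbowPrecoloring k H → GraphSystem k n → ℕ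
rainbowCopyCount {k} {n} H ψ 𝒢 = length (filter (isRainbowCopy? H ψ 𝒢) (allCopies k n H))

{-# OPTIONS --safe #-}
-- For a fixed colouring of H and each pair a, b of its vertices, merge the
-- parallel edges into the relation "u ≠ v and all edges between a and b are
-- present in their colours".  For these finitely many relations at once we
-- maintain a partition of the vertices and, for each relation, a sparse
-- region: a disjoint union of rectangles of density below 1/D, measurable
-- with respect to the partition.  If a pair of cells A, B outside the region
-- contains a sparse rectangle X × Y occupying a 1/L fraction of each side, add
-- that rectangle to the region and refine the partition by X and Y.  When such
-- pairs cover a positive fraction of all pairs, the region grows by a fixed
-- fraction, so after boundedly many steps they do not; no energy function is
-- needed.  Deleting the edges that lie in sparse regions, in the exceptional
-- pairs, or at small cells is cheap.  Every pair of cells joined by a surviving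
-- edge is hereditarily dense, so one surviving copy forces a positive
-- proportion of all vertex maps to be copies, by a greedy embedding.
-- Nonadjacent pairs are dense for the relation u ≠ v, which keeps the counted
-- maps injective.
module Submission where

open import Defs

module Removal where

  open import Data.Bool using (Bool; true; false; _∧_; _∨_; not)
  import Data.Bool.Properties as Bool
  open import Data.Fin as Fin using (Fin; zero; suc; combine; remQuot; finToFun; funToFin)
  open import Data.Fin.Properties using (all?; any?; _≟_; <-cmp; nonZeroIndex; remQuot-combine; finToFun-funToFin)
  open import Data.Fin.Subset.Properties using (anySubset?)
  open import Data.List as List using (List; []; _∷_; _++_; length; filter; map; concatMap; cartesianProduct; allFin; tabulate)
  open import Data.List.Membership.Propositional using (_∈_; lose)
  open import Data.List.Membership.Propositional.Properties using (∈-cartesianProduct⁺; ∈-allFin; ∈-concatMap⁺; ∈-map⁺)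
  open import Data.List.Properties using (filter-++; length-++; filter-some)
  open import Data.List.Relation.Unary.Any as Any using (here)
  open import Data.List.Relation.Unary.Any.Properties using (lookup-index)
  open import Data.Maybe using (just)
  open import Data.Nat using (ℕ; zero; suc; pred; _+_; _*_; _^_; _≤_; _<_; z≤n; s≤s; z<s; s<s; _≤?_; _<?_; >-nonZero)
  open import Data.Nat.Properties hiding (_≟_; <-cmp)
  open import Algebra.Properties.Semiring.Sum +-*-semiring
    using (sum; sum-syntax; ∑-distrib-+; ∑-comm; *-distribˡ-sum; *-distribʳ-sum)
  open import Data.Nat.Solver using (module +-*-Solver)
  open import Data.Product using (_×_; _,_; proj₁; proj₂; ∃; ∃₂; uncurry)
  open import Data.Product.Properties using (≡-dec)
  open import Data.Sum using (_⊎_; inj₁; inj₂; [_,_]′; swap)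
  open import Data.Vec as Vec using (Vec)
  open import Data.Vec.Properties using (lookup∘tabulate)
  open import Function using (_∘_; id)
  open import Relation.Binary.Definitions using (tri<; tri≈; tri>)
  open import Relation.Binary.PropositionalEquality as ≡ using (_≡_; _≢_; _≗_; refl; trans; cong; cong₂; subst)
  open import Relation.Nullary using (Dec; yes; no; ¬_; does; contradiction)
  open import Relation.Nullary.Decidable using (dec-true; _×-dec_; _→-dec_; _⊎-dec_; ¬?)
  open import Relation.Unary using (Decidable)
  open ≤-Reasoning
  open +-*-Solver using (solve; _:*_; _:+_; _:=_; con)

  private variable
    n m k l : ℕ

  from-does : ∀ {ℓ} {P : Set ℓ} (P? : Dec P) → does P? ≡ true → P
  from-does (yes p) _ = p

  -- Sums over Fin n

  ∑-mono : {f g : Fin n → ℕ} → (∀ i → f i ≤ g i) → sum f ≤ sum g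
  ∑-mono {zero}  _   = z≤n
  ∑-mono {suc n} f≤g = +-mono-≤ (f≤g zero) (∑-mono (f≤g ∘ suc))

  ∑-const : ∀ n c → ∑[ _ < n ] c ≡ n * c
  ∑-const zero    c = refl
  ∑-const (suc n) c = cong (c +_) (∑-const n c)

  prod : (Fin l → ℕ) → ℕ
  prod {zero}  f = 1
  prod {suc l} f = f zero * prod (f ∘ suc)

  prod-mono-scaled : ∀ c {f g : Fin l → ℕ} → (∀ i → f i ≤ c * g i) → prod f ≤ c ^ l * prod g
  prod-mono-scaled {zero}  c f≤cg = ≤-refl
  prod-mono-scaled {suc l} c {f} {g} f≤cg = begin
    f zero * prod (f ∘ suc)                     ≤⟨ *-mono-≤ (f≤cg zero) (prod-mono-scaled c (f≤cg ∘ suc)) ⟩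
    (c * g zero) * (c ^ l * prod (g ∘ suc))     ≡⟨ solve 4 (λ a b d e → (a :* b) :* (d :* e) := (a :* d) :* (b :* e)) refl c (g zero) (c ^ l) _ ⟩
    c ^ suc l * (g zero * prod (g ∘ suc))       ∎

  prod-const : ∀ h c → prod {h} (λ _ → c) ≡ c ^ h
  prod-const zero    c = refl
  prod-const (suc h) c = cong (c *_) (prod-const h c)

  -- Sets, relations and densities

  Sub : ℕ → Set
  Sub n = Fin n → Bool

  Rel : ℕ → Set
  Rel n = Fin n → Fin n → Bool

  ⟦_⟧ : Bool → ℕ
  ⟦ true ⟧  = 1
  ⟦ false ⟧ = 0

  ⟦⟧-∧ : ∀ a b → ⟦ a ∧ b ⟧ ≡ ⟦ a ⟧ * ⟦ b ⟧
  ⟦⟧-∧ true  b = ≡.sym (*-identityˡ ⟦ b ⟧)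
  ⟦⟧-∧ false b = refl

  ⟦⟧≤1 : ∀ b → ⟦ b ⟧ ≤ 1
  ⟦⟧≤1 true  = ≤-refl
  ⟦⟧≤1 false = z≤n

  ⟦⟧-mono : ∀ {a b} → (a ≡ true → b ≡ true) → ⟦ a ⟧ ≤ ⟦ b ⟧
  ⟦⟧-mono {false} _   = z≤n
  ⟦⟧-mono {true}  a⇒b rewrite a⇒b refl = ≤-refl

  ⟦⟧*-mono : ∀ b {x y} → (b ≡ true → x ≤ y) → ⟦ b ⟧ * x ≤ ⟦ b ⟧ * y
  ⟦⟧*-mono false _   = z≤n
  ⟦⟧*-mono true  x≤y = *-monoʳ-≤ 1 (x≤y refl)

  ∧-true : ∀ {a b} → a ∧ b ≡ true → a ≡ true × b ≡ true
  ∧-true {true} {true} _ = refl , refl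

  infix 4 _⊆_
  _⊆_ : Sub n → Sub n → Set
  X ⊆ Y = ∀ v → X v ≡ true → Y v ≡ true

  card : Sub n → ℕ
  card {n} X = ∑[ v < n ] ⟦ X v ⟧

  nbr : Rel n → Sub n → Fin n → Sub n
  nbr R Y u v = Y v ∧ R u v

  edges : Rel n → Sub n → Sub n → ℕ
  edges {n} R X Y = ∑[ u < n ] (⟦ X u ⟧ * card (nbr R Y u))

  -- Hereditary density 1/D, down to subsets occupying a 1/L fraction of each side.
  Dense : Rel n → (L D : ℕ) → Sub n → Sub n → Set
  Dense R L D A B = ∀ X Y → X ⊆ A → Y ⊆ B → card A ≤ L * card X → card B ≤ L * card Y →
                    card X * card Y ≤ D * edges R X Y

  -- Counting lemma

  -- Embeddings are counted greedily: placing vertex zero at `v` shrinks every later candidate set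
  -- to the neighbours of `v`, so the condition on a pair is imposed when its earlier vertex is
  -- placed.
  homs : ∀ h → (Fin h → Sub n) → (Fin h → Fin h → Rel n) → ℕ
  homs         zero    W R = 1
  homs {n = n} (suc h) W R =
    ∑[ v < n ] (⟦ W zero v ⟧ * homs h (λ j → nbr (R zero (suc j)) (W (suc j)) v) (λ a b → R (suc a) (suc b)))

  -- The term 2 * h ensures that at most half of the candidates for a vertex have
  -- too few neighbours in one of the h remaining sets; the term D * threshold D h
  -- allows these sets to shrink by a factor D.
  threshold : (D h : ℕ) → ℕ
  threshold D zero    = 1
  threshold D (suc h) = 1 + 2 * h + D * threshold D h

  -- The factor 2 pays for the bad positions of the first vertex, the factor `D ^ h` for the
  -- shrinking of the `h` remaining candidate sets.
  loss : (D h : ℕ) → ℕ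
  loss D zero    = 1
  loss D (suc h) = 2 * (D ^ h * loss D h)

  module _ (D L : ℕ) (1≤L : 1 ≤ L) (A B : Sub n) (R : Rel n) (dense : Dense R L D A B) where

    sparseVertices : Sub n
    sparseVertices v = A v ∧ does (D * card (nbr R B v) <? card B)

    -- If the sparse vertices filled a 1/L fraction of `A`, density would apply to them against the
    -- whole of `B`; but each has fewer than |B|/D neighbours there, so there would be none at all.
    few-sparseVertices : L * card sparseVertices ≤ card A
    few-sparseVertices with ≤-total (card A) (L * card sparseVertices)
    ... | inj₂ L|X|≤|A| = L|X|≤|A|
    ... | inj₁ |A|≤L|X| = ≤-trans (*-monoʳ-≤ L |X|≤0) (≤-trans (≤-reflexive (*-zeroʳ L)) z≤n)
      where
      X = sparseVertices
      -- The summand `⟦ X v ⟧` records strictness at each sparse vertex; in the sum it becomes the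
      -- surplus `card X`.
      degree-deficit : ∀ v → D * (⟦ X v ⟧ * card (nbr R B v)) + ⟦ X v ⟧ ≤ ⟦ X v ⟧ * card B
      degree-deficit v with X v in eq
      ... | false rewrite *-zeroʳ D = z≤n
      ... | true  rewrite *-identityˡ (card (nbr R B v)) | *-identityˡ (card B)
                        | +-comm (D * card (nbr R B v)) 1 =
        from-does (D * card (nbr R B v) <? card B) (proj₂ (∧-true eq))
      deficit : D * edges R X B + card X ≤ 0 + D * edges R X B
      deficit = begin
        D * edges R X B + card X
          ≡⟨ cong (_+ card X) (*-distribˡ-sum {n} D _) ⟩
        ∑[ v < n ] (D * (⟦ X v ⟧ * card (nbr R B v))) + card X
          ≡⟨ ∑-distrib-+ {n} _ _ ⟨
        ∑[ v < n ] (D * (⟦ X v ⟧ * card (nbr R B v)) + ⟦ X v ⟧)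
          ≤⟨ ∑-mono degree-deficit ⟩
        ∑[ v < n ] (⟦ X v ⟧ * card B)
          ≡⟨ *-distribʳ-sum (card B) (λ v → ⟦ X v ⟧) ⟨
        card X * card B
          ≤⟨ dense X B (λ v → proj₁ ∘ ∧-true) (λ _ → id) |A|≤L|X| (m≤n*m (card B) L ⦃ >-nonZero 1≤L ⦄) ⟩
        D * edges R X B ∎
      |X|≤0 : card X ≤ 0
      |X|≤0 = +-cancelˡ-≤ (D * edges R X B) (card X) 0 (≤-trans deficit (≤-reflexive (+-comm 0 _)))

  -- A 1/L′ fraction of a 1/D fraction is a 1/(D L′) fraction, so only the size parameter degrades
  -- while the density 1/D survives.
  Dense-restrict : ∀ {D L L′} {R : Rel n} {A B A′ B′} → D * L′ ≤ L → Dense R L D A B → A′ ⊆ A → B′ ⊆ B →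
                   card A ≤ D * card A′ → card B ≤ D * card B′ → Dense R L′ D A′ B′
  Dense-restrict {D = D} {L} {L′} DL′≤L dense A′⊆A B′⊆B a b X Y X⊆A′ Y⊆B′ x y =
    dense X Y (λ v → A′⊆A v ∘ X⊆A′ v) (λ v → B′⊆B v ∘ Y⊆B′ v) (widen a x) (widen b y)
    where
    widen : ∀ {p q r} → p ≤ D * q → q ≤ L′ * r → p ≤ L * r
    widen {p} {q} {r} p≤Dq q≤L′r = begin
      p            ≤⟨ p≤Dq ⟩
      D * q        ≤⟨ *-monoʳ-≤ D q≤L′r ⟩
      D * (L′ * r) ≡⟨ *-assoc D L′ r ⟨
      D * L′ * r   ≤⟨ *-monoˡ-≤ r DL′≤L ⟩
      L * r        ∎

  -- Induction on the number of vertices. A good vertex of `W zero` keeps a 1/D fraction of every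
  -- later set, and at least half of `W zero` is good; once one is placed, the shrunken sets are
  -- dense with the next threshold.
  counting : ∀ D h (W : Fin h → Sub n) (R : Fin h → Fin h → Rel n) →
             (∀ a b → a Fin.< b → Dense (R a b) (threshold D h) D (W a) (W b)) →
             prod (card ∘ W) ≤ loss D h * homs h W R
  counting D zero W R dense = ≤-refl
  counting {n} D (suc h) W R dense = begin
    card (W zero) * Π                    ≤⟨ *-monoˡ-≤ Π half-good ⟩
    2 * card good * Π                    ≡⟨ *-assoc 2 (card good) Π ⟩
    2 * (card good * Π)                  ≡⟨ cong (2 *_) (*-distribʳ-sum Π (λ v → ⟦ good v ⟧)) ⟩
    2 * ∑[ v < n ] (⟦ good v ⟧ * Π)      ≤⟨ *-monoʳ-≤ 2 (∑-mono extend) ⟩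
    2 * ∑[ v < n ] (c * (⟦ W zero v ⟧ * rest v)) ≡⟨ cong (2 *_) (*-distribˡ-sum {n} c _) ⟨
    2 * (c * homs (suc h) W R)           ≡⟨ *-assoc 2 c _ ⟨
    loss D (suc h) * homs (suc h) W R    ∎
    where
    L  = threshold D (suc h)
    c  = D ^ h * loss D h
    Π  = prod (card ∘ W ∘ suc)
    W′ : Fin n → Fin h → Sub n
    W′ v j = nbr (R zero (suc j)) (W (suc j)) v
    rest : Fin n → ℕ
    rest v = homs h (W′ v) (λ a b → R (suc a) (suc b))
    good? : ∀ v → Dec (∀ j → card (W (suc j)) ≤ D * card (W′ v j))
    good? v = all? (λ j → card (W (suc j)) ≤? D * card (W′ v j))
    good : Sub n
    good v = W zero v ∧ does (good? v)
    bad : Fin h → Sub n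
    bad j = sparseVertices D L (s≤s z≤n) (W zero) (W (suc j)) (R zero (suc j)) (dense zero (suc j) z<s)

    good-or-bad : ∀ v → ⟦ W zero v ⟧ ≤ ⟦ good v ⟧ + ∑[ j < h ] ⟦ bad j v ⟧
    good-or-bad v = split (W zero v) (good? v)
      where
      some-bad : ∀ h (x y : Fin h → ℕ) → ¬ (∀ j → x j ≤ y j) → 1 ≤ ∑[ j < h ] ⟦ does (y j <? x j) ⟧
      some-bad zero    x y ¬all = contradiction (λ ()) ¬all
      some-bad (suc h) x y ¬all with ≤-<-connex (x zero) (y zero)
      ... | inj₂ y<x = ≤-trans (≤-reflexive (cong ⟦_⟧ (≡.sym (dec-true (y zero <? x zero) y<x)))) (m≤m+n _ _)
      ... | inj₁ x≤y = ≤-trans (some-bad h (x ∘ suc) (y ∘ suc) (λ all → ¬all λ { zero → x≤y ; (suc j) → all j }))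
                               (m≤n+m _ _)
      split : ∀ {h} {x y : Fin h → ℕ} b (g? : Dec (∀ j → x j ≤ y j)) →
              ⟦ b ⟧ ≤ ⟦ b ∧ does g? ⟧ + ∑[ j < h ] ⟦ b ∧ does (y j <? x j) ⟧
      split false _       = z≤n
      split true  (yes _) = s≤s z≤n
      split true  (no ¬g) = some-bad _ _ _ ¬g

    few-bad : 2 * ∑[ j < h ] card (bad j) ≤ card (W zero)
    few-bad = cancel h (λ j → card (bad j)) λ j → begin
      (2 * h) * card (bad j) ≤⟨ *-monoˡ-≤ (card (bad j)) (≤-trans (n≤1+n _) (m≤m+n (1 + 2 * h) (D * threshold D h))) ⟩
      L * card (bad j)       ≤⟨ few-sparseVertices D L (s≤s z≤n) (W zero) (W (suc j)) (R zero (suc j)) (dense zero (suc j) z<s) ⟩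
      card (W zero)          ∎
      where
      cancel : ∀ h (x : Fin h → ℕ) {w} → (∀ j → (2 * h) * x j ≤ w) → 2 * ∑[ j < h ] x j ≤ w
      cancel zero _ _ = z≤n
      cancel h@(suc _) x {w} le = *-cancelˡ-≤ h (begin
        h * (2 * sum x)             ≡⟨ trans (≡.sym (*-assoc h 2 (sum x))) (cong (_* sum x) (*-comm h 2)) ⟩
        (2 * h) * sum x             ≡⟨ *-distribˡ-sum (2 * h) x ⟩
        ∑[ j < h ] ((2 * h) * x j)  ≤⟨ ∑-mono le ⟩
        ∑[ _ < h ] w                ≡⟨ ∑-const h w ⟩
        h * w                       ∎)

    half-good : card (W zero) ≤ 2 * card good
    -- Twice the union bound, in which the bad vertices cost at most one `card (W zero)`; cancelling
    -- that term replaces a subtraction.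
    half-good = +-cancelʳ-≤ (card (W zero)) (card (W zero)) (2 * card good) (begin
      card (W zero) + card (W zero)                          ≡⟨ cong (card (W zero) +_) (+-identityʳ _) ⟨
      2 * card (W zero)                                      ≤⟨ *-monoʳ-≤ 2 (∑-mono good-or-bad) ⟩
      2 * ∑[ v < n ] (⟦ good v ⟧ + ∑[ j < h ] ⟦ bad j v ⟧)   ≡⟨ cong (2 *_) (∑-distrib-+ (λ v → ⟦ good v ⟧) _) ⟩
      2 * (card good + ∑[ v < n ] ∑[ j < h ] ⟦ bad j v ⟧)    ≡⟨ cong (λ z → 2 * (card good + z)) (∑-comm (λ v j → ⟦ bad j v ⟧)) ⟩
      2 * (card good + ∑[ j < h ] card (bad j))              ≡⟨ *-distribˡ-+ 2 (card good) _ ⟩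
      2 * card good + 2 * ∑[ j < h ] card (bad j)            ≤⟨ +-monoʳ-≤ (2 * card good) few-bad ⟩
      2 * card good + card (W zero)                          ∎)

    extend : ∀ v → ⟦ good v ⟧ * Π ≤ c * (⟦ W zero v ⟧ * rest v)
    extend v = begin
      ⟦ good v ⟧ * Π                        ≤⟨ ⟦⟧*-mono (good v) (large ∘ from-does (good? v) ∘ proj₂ ∘ ∧-true) ⟩
      ⟦ good v ⟧ * (c * rest v)             ≤⟨ *-monoˡ-≤ (c * rest v) (⟦⟧-mono (proj₁ ∘ ∧-true {W zero v})) ⟩
      ⟦ W zero v ⟧ * (c * rest v)           ≡⟨ solve 3 (λ x y z → x :* (y :* z) := y :* (x :* z)) refl ⟦ W zero v ⟧ c (rest v) ⟩
      c * (⟦ W zero v ⟧ * rest v)           ∎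
      where
      large : (∀ j → card (W (suc j)) ≤ D * card (W′ v j)) → Π ≤ c * rest v
      large g = begin
        Π                                     ≤⟨ prod-mono-scaled D g ⟩
        D ^ h * prod (card ∘ W′ v)            ≤⟨ *-monoʳ-≤ (D ^ h) (counting D h (W′ v) (λ a b → R (suc a) (suc b)) λ a b a<b →
                                                   Dense-restrict {D = D} {L′ = threshold D h} {R = R (suc a) (suc b)} (m≤n+m _ (1 + 2 * h)) (dense (suc a) (suc b) (s<s a<b))
                                                     (λ _ → proj₁ ∘ ∧-true) (λ _ → proj₁ ∘ ∧-true) (g a) (g b)) ⟩
        D ^ h * (loss D h * rest v)           ≡⟨ *-assoc (D ^ h) (loss D h) (rest v) ⟨
        c * rest v                            ∎

  -- Areas of relations

  ∧-intro : ∀ {a b} → a ≡ true → b ≡ true → a ∧ b ≡ true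
  ∧-intro = cong₂ _∧_

  ∧-last : ∀ a b {c} → a ∧ (b ∧ c) ≡ true → c ≡ true
  ∧-last true true c = c

  ∑-cong : {f g : Fin n → ℕ} → (∀ i → f i ≡ g i) → sum f ≡ sum g
  ∑-cong {zero}  _   = refl
  ∑-cong {suc n} f≡g = cong₂ _+_ (f≡g zero) (∑-cong (f≡g ∘ suc))

  area : Rel n → ℕ
  area {n} Z = ∑[ u < n ] ∑[ v < n ] ⟦ Z u v ⟧

  area-mono : {Y Z : Rel n} → (∀ u v → Y u v ≡ true → Z u v ≡ true) → area Y ≤ area Z
  area-mono Y⇒Z = ∑-mono λ u → ∑-mono λ v → ⟦⟧-mono (Y⇒Z u v)

  area-cong : {Y Z : Rel n} → (∀ u v → Y u v ≡ Z u v) → area Y ≡ area Z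
  area-cong Y≡Z = ∑-cong λ u → ∑-cong λ v → cong ⟦_⟧ (Y≡Z u v)

  area-+ : (Y Z : Rel n) → ∑[ u < n ] ∑[ v < n ] (⟦ Y u v ⟧ + ⟦ Z u v ⟧) ≡ area Y + area Z
  area-+ {n} Y Z = trans
    (∑-cong λ u → ∑-distrib-+ (λ v → ⟦ Y u v ⟧) (λ v → ⟦ Z u v ⟧))
    (∑-distrib-+ (λ u → ∑[ v < n ] ⟦ Y u v ⟧) (λ u → ∑[ v < n ] ⟦ Z u v ⟧))

  area-∨ : (X Y Z : Rel n) → (∀ u v → ⟦ X u v ⟧ ≤ ⟦ Y u v ⟧ + ⟦ Z u v ⟧) → area X ≤ area Y + area Z
  area-∨ X Y Z X≤Y+Z = ≤-trans (∑-mono λ u → ∑-mono λ v → X≤Y+Z u v) (≤-reflexive (area-+ Y Z))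

  -- The hypothesis carries disjointness: an indicator is at most 1, so `Y` and `Z` never hold
  -- together.
  area-⊎ : (X Y Z : Rel n) → (∀ u v → ⟦ Y u v ⟧ + ⟦ Z u v ⟧ ≤ ⟦ X u v ⟧) → area Y + area Z ≤ area X
  area-⊎ X Y Z X≥Y+Z = ≤-trans (≤-reflexive (≡.sym (area-+ Y Z))) (∑-mono λ u → ∑-mono λ v → X≥Y+Z u v)

  area-∅ : ∀ n → area {n} (λ _ _ → false) ≡ 0
  area-∅ n = trans (∑-cong {n} {g = λ _ → 0} λ _ → ∑0 n) (∑0 n)
    where
    ∑0 : ∀ n → ∑[ _ < n ] 0 ≡ 0
    ∑0 n = trans (∑-const n 0) (*-zeroʳ n)

  area-false : {Z : Rel n} → (∀ u v → Z u v ≡ true → false ≡ true) → area Z ≡ 0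
  area-false {n} Z⇒⊥ = n≤0⇒n≡0 (≤-trans (area-mono Z⇒⊥) (≤-reflexive (area-∅ n)))

  area≤n² : (Z : Rel n) → area Z ≤ n * n
  area≤n² {n} Z = begin
    area Z              ≤⟨ ∑-mono (λ u → ∑-mono λ v → ⟦⟧≤1 (Z u v)) ⟩
    ∑[ _ < n ] ∑[ _ < n ] 1  ≡⟨ trans (∑-const n _) (cong (n *_) (trans (∑-const n 1) (*-identityʳ n))) ⟩
    n * n               ∎

  area-rectangle : (R : Rel n) (X Y : Sub n) → area (λ u v → X u ∧ (Y v ∧ R u v)) ≡ edges R X Y
  area-rectangle {n} R X Y = ∑-cong λ u →
    trans (∑-cong λ v → ⟦⟧-∧ (X u) (nbr R Y u v)) (≡.sym (*-distribˡ-sum {n} ⟦ X u ⟧ _))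

  area-product : (X Y : Sub n) → area (λ u v → X u ∧ Y v) ≡ card X * card Y
  area-product {n} X Y = trans
    (∑-cong λ u → trans (∑-cong λ v → ⟦⟧-∧ (X u) (Y v)) (≡.sym (*-distribˡ-sum {n} ⟦ X u ⟧ _)))
    (≡.sym (*-distribʳ-sum {n} (card Y) (λ u → ⟦ X u ⟧)))

  ∑-point : ∀ {m} (a : Fin m) (f : Fin m → ℕ) → ∑[ b < m ] (⟦ does (a ≟ b) ⟧ * f b) ≡ f a
  ∑-point {suc m} zero f = trans (cong₂ _+_ (*-identityˡ (f zero)) (trans (∑-const m 0) (*-zeroʳ m))) (+-identityʳ _)
  ∑-point {suc m} (suc a) f = ∑-point a (f ∘ suc)

  fibre : (P : Fin n → Fin m) → Fin m → Sub n
  fibre P a v = does (P v ≟ a)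

  ∑-fibres : (P : Fin n → Fin m) (f : Fin m → Fin n → ℕ) →
             ∑[ v < n ] f (P v) v ≡ ∑[ a < m ] ∑[ v < n ] (⟦ fibre P a v ⟧ * f a v)
  ∑-fibres {n} {m} P f = trans (∑-cong λ v → ≡.sym (∑-point (P v) (λ a → f a v)))
                               (∑-comm {n} {m} (λ v a → ⟦ fibre P a v ⟧ * f a v))

  area-fibres : (P : Fin n → Fin m) (Z : Fin m → Fin m → Rel n) →
    area (λ u v → Z (P u) (P v) u v) ≡
    ∑[ a < m ] ∑[ b < m ] area (λ u v → fibre P a u ∧ (fibre P b v ∧ Z a b u v))
  area-fibres {n} {m} P Z = begin-equality
    ∑[ u < n ] ∑[ v < n ] ⟦ Z (P u) (P v) u v ⟧
      ≡⟨ ∑-fibres P (λ a u → ∑[ v < n ] ⟦ Z a (P v) u v ⟧) ⟩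
    ∑[ a < m ] ∑[ u < n ] (⟦ fibre P a u ⟧ * ∑[ v < n ] ⟦ Z a (P v) u v ⟧)
      ≡⟨ ∑-cong (λ a → ∑-cong λ u → trans
           (cong (⟦ fibre P a u ⟧ *_) (∑-fibres P (λ b v → ⟦ Z a b u v ⟧))) (*-distribˡ-sum {m} ⟦ fibre P a u ⟧ _)) ⟩
    ∑[ a < m ] ∑[ u < n ] ∑[ b < m ] (⟦ fibre P a u ⟧ * ∑[ v < n ] (⟦ fibre P b v ⟧ * ⟦ Z a b u v ⟧))
      ≡⟨ ∑-cong {m} (λ a → ∑-comm {n} {m} (λ u b → ⟦ fibre P a u ⟧ * ∑[ v < n ] (⟦ fibre P b v ⟧ * ⟦ Z a b u v ⟧))) ⟩
    ∑[ a < m ] ∑[ b < m ] ∑[ u < n ] (⟦ fibre P a u ⟧ * ∑[ v < n ] (⟦ fibre P b v ⟧ * ⟦ Z a b u v ⟧))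
      ≡⟨ ∑-cong (λ a → ∑-cong λ b → ∑-cong λ u → trans (*-distribˡ-sum {n} ⟦ fibre P a u ⟧ _)
           (∑-cong λ v → ≡.sym (trans (⟦⟧-∧ (fibre P a u) _) (cong (⟦ fibre P a u ⟧ *_) (⟦⟧-∧ (fibre P b v) _))))) ⟩
    ∑[ a < m ] ∑[ b < m ] area (λ u v → fibre P a u ∧ (fibre P b v ∧ Z a b u v)) ∎

  -- Localises a comparison of areas to single pairs of cells, where a rectangle chosen per pair
  -- becomes one fixed rectangle. The factor `c` serves the sparseness of the new rectangles, `d`
  -- the growth of the region.
  area-fibrewise : ∀ c d (P : Fin n → Fin m) (Y Z : Fin m → Fin m → Rel n) →
    (∀ a b → c * area (λ u v → fibre P a u ∧ (fibre P b v ∧ Y a b u v)) ≤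
             d * area (λ u v → fibre P a u ∧ (fibre P b v ∧ Z a b u v))) →
    c * area (λ u v → Y (P u) (P v) u v) ≤ d * area (λ u v → Z (P u) (P v) u v)
  area-fibrewise {n} {m} c d P Y Z le = begin
    c * area (λ u v → Y (P u) (P v) u v) ≡⟨ expand c Y ⟩
    ∑[ a < m ] ∑[ b < m ] (c * block Y a b) ≤⟨ ∑-mono (λ a → ∑-mono (le a)) ⟩
    ∑[ a < m ] ∑[ b < m ] (d * block Z a b) ≡⟨ expand d Z ⟨
    d * area (λ u v → Z (P u) (P v) u v) ∎
    where
    block : (Fin m → Fin m → Rel n) → Fin m → Fin m → ℕ
    block Z a b = area (λ u v → fibre P a u ∧ (fibre P b v ∧ Z a b u v))
    expand : ∀ c Z → c * area (λ u v → Z (P u) (P v) u v) ≡ ∑[ a < m ] ∑[ b < m ] (c * block Z a b)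
    expand c Z = trans (cong (c *_) (area-fibres P Z))
                       (trans (*-distribˡ-sum {m} c _) (∑-cong λ a → *-distribˡ-sum {m} c (block Z a)))

  -- Sparse rectangles

  -- A witness against `Dense R L D A B`.
  record Sparse (R : Rel n) (L D : ℕ) (A B X Y : Sub n) : Set where
    field
      X⊆A    : X ⊆ A
      Y⊆B    : Y ⊆ B
      largeX : card A ≤ L * card X
      largeY : card B ≤ L * card Y
      sparse : D * edges R X Y < card X * card Y

  -- The search for witnesses runs over Boolean vectors, and a tabulated set agrees with the
  -- original one only pointwise.
  Sparse-resp : ∀ {R : Rel n} {L D A B X X′ Y Y′} → X ≗ X′ → Y ≗ Y′ → Sparse R L D A B X Y → Sparse R L D A B X′ Y′
  Sparse-resp {R = R} {L} {D} {A} {B} {X} {X′} {Y} {Y′} X≗ Y≗ s = record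
    { X⊆A    = λ v → s .Sparse.X⊆A v ∘ trans (X≗ v)
    ; Y⊆B    = λ v → s .Sparse.Y⊆B v ∘ trans (Y≗ v)
    ; largeX = subst (λ x → card A ≤ L * x) cardX (s .Sparse.largeX)
    ; largeY = subst (λ x → card B ≤ L * x) cardY (s .Sparse.largeY)
    ; sparse = ≡.subst₂ _<_ (cong (D *_) edges≡) (cong₂ _*_ cardX cardY) (s .Sparse.sparse)
    }
    where
    cardX : card X ≡ card X′
    cardX = ∑-cong (cong ⟦_⟧ ∘ X≗)
    cardY : card Y ≡ card Y′
    cardY = ∑-cong (cong ⟦_⟧ ∘ Y≗)
    edges≡ : edges R X Y ≡ edges R X′ Y′
    edges≡ = ∑-cong λ u → cong₂ _*_ (cong ⟦_⟧ (X≗ u)) (∑-cong λ v → cong (λ y → ⟦ y ∧ R u v ⟧) (Y≗ v))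

  _⊆?_ : (X Y : Sub n) → Dec (X ⊆ Y)
  X ⊆? Y = all? λ v → (X v Bool.≟ true) →-dec (Y v Bool.≟ true)

  sparse? : (R : Rel n) (L D : ℕ) (A B X Y : Sub n) → Dec (Sparse R L D A B X Y)
  sparse? R L D A B X Y with (X ⊆? A) ×-dec (Y ⊆? B) ×-dec (card A ≤? L * card X) ×-dec (card B ≤? L * card Y)
                             ×-dec (D * edges R X Y <? card X * card Y)
  ... | yes (a , b , c , d , f) = yes record { X⊆A = a ; Y⊆B = b ; largeX = c ; largeY = d ; sparse = f }
  ... | no ¬all = no λ s → let open Sparse s in ¬all (X⊆A , Y⊆B , largeX , largeY , sparse)

  -- There are finitely many pairs of subsets, so exhaustive search either finds a witness or
  -- refutes every candidate, and the latter is density.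
  dense-or-sparse : (R : Rel n) (L D : ℕ) (A B : Sub n) →
                    Dense R L D A B ⊎ (∃₂ λ X Y → Sparse R L D A B X Y)
  dense-or-sparse R L D A B
    with anySubset? (λ p → anySubset? (λ q → sparse? R L D A B (Vec.lookup p) (Vec.lookup q)))
  ... | yes (p , q , s) = inj₂ (Vec.lookup p , Vec.lookup q , s)
  ... | no none = inj₁ λ X Y X⊆A Y⊆B a b → ≮⇒≥ λ s → none (Vec.tabulate X , Vec.tabulate Y ,
          Sparse-resp (≡.sym ∘ lookup∘tabulate X) (≡.sym ∘ lookup∘tabulate Y)
            record { X⊆A = X⊆A ; Y⊆B = Y⊆B ; largeX = a ; largeY = b ; sparse = s })

  -- Sparse–dense partitions

  -- One bit for each relation and ordered pair of cells, telling whether a vertex lies in the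
  -- corresponding side of the rectangle chosen there. The count is independent of the number of
  -- vertices.
  codes : ℕ → ℕ → ℕ
  codes r m = 2 ^ (r * (m * m))

  module _ {r m : ℕ} where

    fromBit : Fin 2 → Bool
    fromBit zero    = false
    fromBit (suc _) = true

    toBit : Bool → Fin 2
    toBit false = zero
    toBit true  = suc zero

    fromBit-toBit : ∀ b → fromBit (toBit b) ≡ b
    fromBit-toBit true  = refl
    fromBit-toBit false = refl

    bits : (Fin r → Fin m → Fin m → Bool) → Fin (r * (m * m)) → Fin 2
    bits Z = toBit ∘ uncurry (λ x → uncurry (Z x) ∘ remQuot {m} m) ∘ remQuot {r} (m * m)

    code : (Fin r → Fin m → Fin m → Bool) → Fin (codes r m)
    code Z = funToFin (bits Z)

    decode : Fin (codes r m) → Fin r → Fin m → Fin m → Bool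
    decode c x a b = fromBit (finToFun {2} {r * (m * m)} c (combine x (combine a b)))

    decode-code : ∀ Z x a b → decode (code Z) x a b ≡ Z x a b
    decode-code Z x a b = trans (cong fromBit (trans (finToFun-funToFin (bits Z) (combine x (combine a b))) bit))
                                (fromBit-toBit (Z x a b))
      where
      bit : bits Z (combine x (combine a b)) ≡ toBit (Z x a b)
      bit = cong toBit (trans (cong (uncurry (λ x → uncurry (Z x) ∘ remQuot {m} m)) (remQuot-combine x (combine a b)))
                              (cong (uncurry (Z x)) (remQuot-combine a b)))

    -- A refined cell is named by its old cell, the code of the left sides containing it and the
    -- code of the right sides containing it.
    unpair : Fin ((m * codes r m) * codes r m) → Fin m × Fin (codes r m) × Fin (codes r m)
    unpair = uncurry (λ pa b → let p , a = remQuot {m} (codes r m) pa in p , a , b) ∘ remQuot {m * codes r m} (codes r m)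

    unpair-combine : ∀ p a b → unpair (combine (combine p a) b) ≡ (p , a , b)
    unpair-combine p a b = trans
      (cong (uncurry (λ pa b → let p , a = remQuot {m} (codes r m) pa in p , a , b)) (remQuot-combine (combine p a) b))
      (cong (λ (p , a) → p , a , b) (remQuot-combine p a))

  module Regularity {n r : ℕ} (R : Fin r → Rel n) (L D : ℕ) where

    -- `S x` is the sparse region of relation `x`, given by cell indices and hence measurable. The
    -- density bound is not strict, which admits the empty region at the start.
    record Partition (m : ℕ) : Set where
      field
        P      : Fin n → Fin m
        S      : Fin r → Fin m → Fin m → Bool
        sparse : ∀ x → D * area (λ u v → S x (P u) (P v) ∧ R x u v) ≤ area (λ u v → S x (P u) (P v))

      search : ∀ x a b → Dense (R x) L D (fibre P a) (fibre P b) ⊎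
                         (∃₂ λ X Y → Sparse (R x) L D (fibre P a) (fibre P b) X Y)
      search x a b = dense-or-sparse (R x) L D (fibre P a) (fibre P b)

      irregular : Fin r → Fin m → Fin m → Bool
      irregular x a b with S x a b | search x a b
      ... | false | inj₂ _ = true
      ... | _     | _      = false

      left right : Fin r → Fin m → Fin m → Sub n
      left x a b with search x a b
      -- A dense pair offers no rectangle; the empty default is masked by `irregular` in `new`.
      ... | inj₁ _           = λ _ → false
      ... | inj₂ (X , _ , _) = X
      right x a b with search x a b
      ... | inj₁ _           = λ _ → false
      ... | inj₂ (_ , Y , _) = Y

      irregular⇒∉S : ∀ x a b → irregular x a b ≡ true → S x a b ≡ false
      irregular⇒∉S x a b eq with S x a b | search x a b
      ... | false | inj₂ _ = refl

      irregular⇒sparse : ∀ x a b → irregular x a b ≡ true →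
                         Sparse (R x) L D (fibre P a) (fibre P b) (left x a b) (right x a b)
      irregular⇒sparse x a b eq with S x a b | search x a b
      ... | false | inj₂ (_ , _ , s) = s

      regular⇒dense : ∀ x a b → S x a b ≡ false → irregular x a b ≡ false →
                      Dense (R x) L D (fibre P a) (fibre P b)
      regular⇒dense x a b ∉S reg with S x a b | search x a b
      ... | false | inj₁ dense = dense

      sparseArea irregularArea : ℕ
      sparseArea    = ∑[ x < r ] area (λ u v → S x (P u) (P v))
      irregularArea = ∑[ x < r ] area (λ u v → irregular x (P u) (P v))

      -- A ceiling common to all partitions; against it, `growth` can happen only boundedly often.
      sparseArea≤ : sparseArea ≤ r * (n * n)
      sparseArea≤ = ≤-trans (∑-mono λ x → area≤n² (λ u v → S x (P u) (P v))) (≤-reflexive (∑-const r (n * n)))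

    module Refine {m : ℕ} (part : Partition m) where
      open Partition part

      c : ℕ
      c = codes r m

      new : Fin r → Fin m → Fin m → Rel n
      new x a b u v = irregular x a b ∧ (left x a b u ∧ right x a b v)

      P⁺ : Fin n → Fin ((m * c) * c)
      P⁺ v = combine (combine (P v) (code λ x a b → left x a b v)) (code λ x a b → right x a b v)

      -- The left code is read from the first cell and the right code from the second, so the two
      -- refined cells alone decide membership in the new rectangle.
      extend : Fin r → Fin m × Fin c × Fin c → Fin m × Fin c × Fin c → Bool
      extend x (a , l , _) (b , _ , r) = S x a b ∨ (irregular x a b ∧ (decode l x a b ∧ decode r x a b))

      S⁺ : Fin r → Fin ((m * c) * c) → Fin ((m * c) * c) → Bool
      S⁺ x a⁺ b⁺ = extend x (unpair {r} a⁺) (unpair {r} b⁺)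

      S⁺-P⁺ : ∀ x u v → S⁺ x (P⁺ u) (P⁺ v) ≡ S x (P u) (P v) ∨ new x (P u) (P v) u v
      S⁺-P⁺ x u v = trans
        (cong₂ (extend x) (unpair-combine {r} (P u) _ _) (unpair-combine {r} (P v) _ _))
        (cong₂ (λ l r → S x (P u) (P v) ∨ (irregular x (P u) (P v) ∧ (l ∧ r)))
          (decode-code (λ x a b → left x a b u) x (P u) (P v))
          (decode-code (λ x a b → right x a b v) x (P u) (P v)))

      -- Only pairs outside `S x` are irregular, so the new rectangles are disjoint from the old
      -- region and their area counts in full.
      old+new : ∀ x → area (λ u v → S x (P u) (P v)) + area (λ u v → new x (P u) (P v) u v) ≤
                      area (λ u v → S⁺ x (P⁺ u) (P⁺ v))
      old+new x = area-⊎ _ _ _ λ u v → disjoint u v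
        where
        disjoint : ∀ u v → ⟦ S x (P u) (P v) ⟧ + ⟦ new x (P u) (P v) u v ⟧ ≤ ⟦ S⁺ x (P⁺ u) (P⁺ v) ⟧
        disjoint u v rewrite S⁺-P⁺ x u v with irregular x (P u) (P v) in eq
        ... | false = ≤-reflexive (trans (+-identityʳ _) (cong ⟦_⟧ (≡.sym (Bool.∨-identityʳ _))))
        ... | true rewrite irregular⇒∉S x (P u) (P v) eq = ≤-refl

      -- Each pair of cells contributes at most one rectangle, sparse by choice, so the bounds add
      -- up over the pairs. Its sides lie inside the cells, so restricting to the fibres loses none
      -- of its area.
      new-sparse : ∀ x → D * area (λ u v → new x (P u) (P v) u v ∧ R x u v) ≤ area (λ u v → new x (P u) (P v) u v)
      new-sparse x = ≤-trans
        (area-fibrewise D 1 P (λ a b u v → new x a b u v ∧ R x u v) (new x) (λ a b → ≤-trans (block a b) (≤-reflexive (≡.sym (*-identityˡ _)))))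
        (≤-reflexive (*-identityˡ _))
        where
        block : ∀ a b → D * area (λ u v → fibre P a u ∧ (fibre P b v ∧ (new x a b u v ∧ R x u v))) ≤
                        area (λ u v → fibre P a u ∧ (fibre P b v ∧ new x a b u v))
        block a b with irregular x a b in eq
        ... | false rewrite area-false {n} {λ u v → fibre P a u ∧ (fibre P b v ∧ false)} (λ u v p → ∧-last (fibre P a u) (fibre P b v) p)
                          | *-zeroʳ D = z≤n
        ... | true = begin
          D * area (λ u v → fibre P a u ∧ (fibre P b v ∧ ((X u ∧ Y v) ∧ R x u v)))
            ≤⟨ *-monoʳ-≤ D (area-mono λ u v p → trans (≡.sym (Bool.∧-assoc (X u) (Y v) (R x u v))) (∧-last (fibre P a u) (fibre P b v) p)) ⟩
          D * area (λ u v → X u ∧ (Y v ∧ R x u v)) ≡⟨ cong (D *_) (area-rectangle (R x) X Y) ⟩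
          D * edges (R x) X Y                          ≤⟨ <⇒≤ w.sparse ⟩
          card X * card Y                          ≡⟨ area-product X Y ⟨
          area (λ u v → X u ∧ Y v)
            ≤⟨ area-mono (λ u v p → ∧-intro (w.X⊆A u (proj₁ (∧-true p))) (∧-intro (w.Y⊆B v (proj₂ (∧-true p))) p)) ⟩
          area (λ u v → fibre P a u ∧ (fibre P b v ∧ (X u ∧ Y v))) ∎
          where
          X = left x a b
          Y = right x a b
          module w = Sparse (irregular⇒sparse x a b eq)

      refined : Partition ((m * c) * c)
      refined = record
        { P = P⁺
        ; S = S⁺
        ; sparse = λ x → begin
            D * area (λ u v → S⁺ x (P⁺ u) (P⁺ v) ∧ R x u v)
              ≤⟨ *-monoʳ-≤ D (area-∨ _ _ _ (split x)) ⟩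
            D * (area (λ u v → S x (P u) (P v) ∧ R x u v) + area (λ u v → new x (P u) (P v) u v ∧ R x u v))
              ≡⟨ *-distribˡ-+ D _ _ ⟩
            D * area (λ u v → S x (P u) (P v) ∧ R x u v) + D * area (λ u v → new x (P u) (P v) u v ∧ R x u v)
              ≤⟨ +-mono-≤ (sparse x) (new-sparse x) ⟩
            area (λ u v → S x (P u) (P v)) + area (λ u v → new x (P u) (P v) u v)
              ≤⟨ old+new x ⟩
            area (λ u v → S⁺ x (P⁺ u) (P⁺ v)) ∎
        }
        where
        split : ∀ x u v → ⟦ S⁺ x (P⁺ u) (P⁺ v) ∧ R x u v ⟧ ≤ ⟦ S x (P u) (P v) ∧ R x u v ⟧ + ⟦ new x (P u) (P v) u v ∧ R x u v ⟧
        split x u v rewrite S⁺-P⁺ x u v with S x (P u) (P v)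
        ... | true  = m≤m+n _ _
        ... | false = ≤-refl

      -- A chosen rectangle has at least a 1/L fraction of each side, hence at least 1/L² of the
      -- area of its pair of cells.
      growth : irregularArea + L * L * sparseArea ≤ L * L * Partition.sparseArea refined
      growth = begin
        irregularArea + L * L * sparseArea
          ≤⟨ +-monoˡ-≤ _ (∑-mono λ x → ≤-trans (≤-reflexive (≡.sym (*-identityˡ _))) (area-fibrewise 1 (L * L) P (λ a b _ _ → irregular x a b) (new x) (block x))) ⟩
        ∑[ x < r ] (L * L * area (λ u v → new x (P u) (P v) u v)) + L * L * sparseArea
          ≡⟨ cong (_+ L * L * sparseArea) (*-distribˡ-sum {r} (L * L) _) ⟨
        L * L * ∑[ x < r ] area (λ u v → new x (P u) (P v) u v) + L * L * sparseArea
          ≡⟨ trans (+-comm _ (L * L * sparseArea)) (≡.sym (*-distribˡ-+ (L * L) sparseArea _)) ⟩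
        L * L * (sparseArea + ∑[ x < r ] area (λ u v → new x (P u) (P v) u v))
          ≡⟨ cong (L * L *_) (∑-distrib-+ {r} _ _) ⟨
        L * L * ∑[ x < r ] (area (λ u v → S x (P u) (P v)) + area (λ u v → new x (P u) (P v) u v))
          ≤⟨ *-monoʳ-≤ (L * L) (∑-mono old+new) ⟩
        L * L * Partition.sparseArea refined ∎
        where
        block : ∀ x a b → 1 * area (λ u v → fibre P a u ∧ (fibre P b v ∧ irregular x a b)) ≤
                          L * L * area (λ u v → fibre P a u ∧ (fibre P b v ∧ new x a b u v))
        block x a b with irregular x a b in eq
        ... | false rewrite area-false {n} {λ u v → fibre P a u ∧ (fibre P b v ∧ false)} (λ u v p → ∧-last (fibre P a u) (fibre P b v) p) = z≤n
        ... | true = begin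
          1 * area (λ u v → fibre P a u ∧ (fibre P b v ∧ true)) ≡⟨ *-identityˡ _ ⟩
          area (λ u v → fibre P a u ∧ (fibre P b v ∧ true))
            ≡⟨ area-cong (λ u v → cong (fibre P a u ∧_) (Bool.∧-identityʳ (fibre P b v))) ⟩
          area (λ u v → fibre P a u ∧ fibre P b v)             ≡⟨ area-product (fibre P a) (fibre P b) ⟩
          card (fibre P a) * card (fibre P b)                  ≤⟨ *-mono-≤ w.largeX w.largeY ⟩
          (L * card X) * (L * card Y)
            ≡⟨ solve 3 (λ l p q → (l :* p) :* (l :* q) := (l :* l) :* (p :* q)) refl L (card X) (card Y) ⟩
          L * L * (card X * card Y)                            ≡⟨ cong (L * L *_) (area-product X Y) ⟨
          L * L * area (λ u v → X u ∧ Y v)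
            ≤⟨ *-monoʳ-≤ (L * L) (area-mono (λ u v p → ∧-intro (w.X⊆A u (proj₁ (∧-true p))) (∧-intro (w.Y⊆B v (proj₂ (∧-true p))) p))) ⟩
          L * L * area (λ u v → fibre P a u ∧ (fibre P b v ∧ (X u ∧ Y v))) ∎
          where
          X = left x a b
          Y = right x a b
          module w = Sparse (irregular⇒sparse x a b eq)

    trivial : Partition 1
    trivial = record
      { P = λ _ → zero
      ; S = λ _ _ _ → false
      ; sparse = λ _ → ≤-reflexive (trans (cong (D *_) (area-∅ n)) (trans (*-zeroʳ D) (≡.sym (area-∅ n))))
      }

  open Regularity using (Partition)

  -- Iterated refinement.

  module _ (r L D Q : ℕ) where

    -- The invariant says that the scaled sparse area is at most `fuel` times n² below its ceiling.
    -- A refinement gains more than n² and uses one unit of fuel. `M` is fixed before `n` and the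
    -- relations.
    regularise : ∀ fuel m → ∃ λ M → ∀ {n} (R : Fin r → Rel n) (part : Partition R L D m) →
      let open Partition in
      Q * (L * L) * (r * (n * n)) ≤ Q * (L * L) * sparseArea part + fuel * (n * n) →
      ∃ λ m′ → m′ ≤ M × ∃ λ (part′ : Partition R L D m′) → Q * irregularArea part′ ≤ n * n
    regularise fuel m = bound fuel m , λ R part inv → run fuel m R part inv
      where
      next : ℕ → ℕ
      next m = (m * codes r m) * codes r m
      -- The sum of the sizes at all stages dominates the size at whichever stage the run stops.
      bound : ℕ → ℕ → ℕ
      bound zero       m = m
      bound (suc fuel) m = m + bound fuel (next m)
      open Partition

      progress : ∀ {n m} (R : Fin r → Rel n) (part : Partition R L D m) → n * n < Q * irregularArea part →
                 n * n + Q * (L * L) * sparseArea part <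
                 Q * (L * L) * sparseArea (Regularity.Refine.refined R L D part)
      progress {n} R part irr = begin-strict
        n * n + Q * (L * L) * sparseArea part
          <⟨ +-monoˡ-< _ irr ⟩
        Q * irregularArea part + Q * (L * L) * sparseArea part
          ≡⟨ cong (Q * irregularArea part +_) (*-assoc Q (L * L) _) ⟩
        Q * irregularArea part + Q * (L * L * sparseArea part)
          ≡⟨ *-distribˡ-+ Q _ _ ⟨
        Q * (irregularArea part + L * L * sparseArea part)
          ≤⟨ *-monoʳ-≤ Q (Regularity.Refine.growth R L D part) ⟩
        Q * (L * L * sparseArea (Regularity.Refine.refined R L D part))
          ≡⟨ *-assoc Q (L * L) _ ⟨
        Q * (L * L) * sparseArea (Regularity.Refine.refined R L D part) ∎

      run : ∀ fuel m {n} (R : Fin r → Rel n) (part : Partition R L D m) →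
            Q * (L * L) * (r * (n * n)) ≤ Q * (L * L) * sparseArea part + fuel * (n * n) →
            ∃ λ m′ → m′ ≤ bound fuel m × ∃ λ (part′ : Partition R L D m′) → Q * irregularArea part′ ≤ n * n
      run fuel m {n} R part inv with ≤-<-connex (Q * irregularArea part) (n * n)
      run zero       m R part inv | inj₁ ok = m , ≤-refl , part , ok
      run (suc fuel) m R part inv | inj₁ ok = m , m≤m+n m _ , part , ok
      -- Without fuel the sparse area has reached its ceiling, yet a further refinement would
      -- increase it strictly.
      run zero m {n} R part inv | inj₂ irr = contradiction (begin-strict
        Q * (L * L) * (r * (n * n))                  ≤⟨ inv ⟩
        Q * (L * L) * sparseArea part + 0            ≡⟨ +-comm _ 0 ⟩
        Q * (L * L) * sparseArea part                ≤⟨ m≤n+m _ (n * n) ⟩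
        n * n + Q * (L * L) * sparseArea part        <⟨ progress R part irr ⟩
        Q * (L * L) * sparseArea part⁺               ≤⟨ *-monoʳ-≤ (Q * (L * L)) (sparseArea≤ part⁺) ⟩
        Q * (L * L) * (r * (n * n))                  ∎) (<-irrefl refl)
        where part⁺ = Regularity.Refine.refined R L D part
      run (suc fuel) m {n} R part inv | inj₂ irr =
        let m′ , m′≤ , rest = run fuel (next m) R part⁺ (begin
              Q * (L * L) * (r * (n * n))                                ≤⟨ inv ⟩
              Q * (L * L) * sparseArea part + (n * n + fuel * (n * n))
                ≡⟨ solve 3 (λ s a f → s :+ (a :+ f) := (a :+ s) :+ f) refl (Q * (L * L) * sparseArea part) (n * n) _ ⟩
              (n * n + Q * (L * L) * sparseArea part) + fuel * (n * n)   ≤⟨ +-monoˡ-≤ _ (<⇒≤ (progress R part irr)) ⟩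
              Q * (L * L) * sparseArea part⁺ + fuel * (n * n)            ∎)
        in m′ , ≤-trans m′≤ (m≤n+m _ m) , rest
        where part⁺ = Regularity.Refine.refined R L D part

    regularity : ∃ λ M → ∀ {n} (R : Fin r → Rel n) →
      ∃ λ m → m ≤ M × ∃ λ (part : Partition R L D m) → Q * Partition.irregularArea part ≤ n * n
    -- With this fuel the fuel term alone equals the scaled ceiling, so the invariant holds at the
    -- partition into one cell.
    regularity = let M , reg = regularise (Q * (L * L) * r) 1 in
      M , λ {n} R → reg R (Regularity.trivial R L D)
        (≤-trans (≤-reflexive (≡.sym (*-assoc (Q * (L * L)) r (n * n)))) (m≤n+m _ _))

  -- Counting by filtering lists

  module _ {A : Set} {P : A → Set} (P? : Decidable P) where

    length-filter-∷ : ∀ x xs → length (filter P? (x ∷ xs)) ≡ ⟦ does (P? x) ⟧ + length (filter P? xs)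
    length-filter-∷ x xs with does (P? x)
    ... | true  = refl
    ... | false = refl

    length-filter-++ : ∀ xs ys → length (filter P? (xs ++ ys)) ≡ length (filter P? xs) + length (filter P? ys)
    length-filter-++ xs ys = trans (cong length (filter-++ P? xs ys)) (length-++ (filter P? xs))

    length-filter-map : ∀ {B : Set} (f : B → A) xs → length (filter P? (map f xs)) ≡ length (filter (P? ∘ f) xs)
    length-filter-map f []       = refl
    length-filter-map f (x ∷ xs) with does (P? (f x))
    ... | true  = cong suc (length-filter-map f xs)
    ... | false = length-filter-map f xs

    length-filter-tabulate : (f : Fin n → A) → length (filter P? (tabulate f)) ≡ ∑[ i < n ] ⟦ does (P? (f i)) ⟧
    length-filter-tabulate {zero}  f = refl
    length-filter-tabulate {suc n} f = trans (length-filter-∷ (f zero) (tabulate (f ∘ suc)))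
      (cong (⟦ does (P? (f zero)) ⟧ +_) (length-filter-tabulate (f ∘ suc)))

    length-filter-concatMap : ∀ {B : Set} (g : B → List A) (f : Fin n → B) →
      length (filter P? (concatMap g (tabulate f))) ≡ ∑[ i < n ] length (filter P? (g (f i)))
    length-filter-concatMap {zero}  g f = refl
    length-filter-concatMap {suc n} g f = trans (length-filter-++ (g (f zero)) _)
      (cong (length (filter P? (g (f zero))) +_) (length-filter-concatMap g (f ∘ suc)))

  length-filter-⊎ : ∀ {A : Set} {P Q Z : A → Set} (P? : Decidable P) (Q? : Decidable Q) (Z? : Decidable Z) →
    (∀ {x} → P x → Q x ⊎ Z x) → ∀ xs → length (filter P? xs) ≤ length (filter Q? xs) + length (filter Z? xs)
  length-filter-⊎ P? Q? Z? split [] = z≤n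
  length-filter-⊎ P? Q? Z? split (x ∷ xs)
    rewrite length-filter-∷ P? x xs | length-filter-∷ Q? x xs | length-filter-∷ Z? x xs = begin
    p + length (filter P? xs)            ≤⟨ +-mono-≤ (here≤ (P? x) (Q? x) (Z? x)) (length-filter-⊎ P? Q? Z? split xs) ⟩
    (q + z) + (length (filter Q? xs) + length (filter Z? xs))
      ≡⟨ solve 4 (λ a b c d → (a :+ b) :+ (c :+ d) := (a :+ c) :+ (b :+ d)) refl q z _ _ ⟩
    (q + length (filter Q? xs)) + (z + length (filter Z? xs)) ∎
    where
    p = ⟦ does (P? x) ⟧
    q = ⟦ does (Q? x) ⟧
    z = ⟦ does (Z? x) ⟧
    here≤ : (P?x : Dec _) (Q?x : Dec _) (Z?x : Dec _) → ⟦ does P?x ⟧ ≤ ⟦ does Q?x ⟧ + ⟦ does Z?x ⟧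
    here≤ (no _)  _       _       = z≤n
    here≤ (yes _) (yes _) _       = s≤s z≤n
    here≤ (yes _) (no _)  (yes _) = s≤s z≤n
    here≤ (yes p) (no ¬q) (no ¬z) = contradiction (split p) [ ¬q , ¬z ]′

  length-filter-cartesianProduct : ∀ {A B : Set} {P : A × B → Set} (P? : Decidable P) (f : Fin n → A) ys →
    length (filter P? (cartesianProduct (tabulate f) ys)) ≡ ∑[ i < n ] length (filter (P? ∘ (f i ,_)) ys)
  length-filter-cartesianProduct {zero}  P? f ys = refl
  length-filter-cartesianProduct {suc n} P? f ys = trans (length-filter-++ P? (map (f zero ,_) ys) _)
    (cong₂ _+_ (length-filter-map P? (f zero ,_) ys) (length-filter-cartesianProduct P? (f ∘ suc) ys))

  -- Lets the copies with one fixed colouring bound the number of all copies from below.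
  length-filter-slice : ∀ {A B : Set} {P : A × B → Set} (P? : Decidable P) {c : B} xs {ys} → c ∈ ys →
    length (filter (λ x → P? (x , c)) xs) ≤ length (filter P? (cartesianProduct xs ys))
  length-filter-slice P? [] c∈ys = z≤n
  length-filter-slice P? {c} (x ∷ xs) {ys} c∈ys = begin
    length (filter (λ x → P? (x , c)) (x ∷ xs))
      ≡⟨ length-filter-∷ (λ x → P? (x , c)) x xs ⟩
    ⟦ does (P? (x , c)) ⟧ + length (filter (λ x → P? (x , c)) xs)
      ≤⟨ +-mono-≤ first (length-filter-slice P? xs c∈ys) ⟩
    length (filter P? (map (x ,_) ys)) + length (filter P? (cartesianProduct xs ys))
      ≡⟨ length-filter-++ P? (map (x ,_) ys) _ ⟨
    length (filter P? (cartesianProduct (x ∷ xs) ys)) ∎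
    where
    first : ⟦ does (P? (x , c)) ⟧ ≤ length (filter P? (map (x ,_) ys))
    first with P? (x , c)
    ... | no _  = z≤n
    ... | yes p = filter-some P? (lose (∈-map⁺ (x ,_) c∈ys) p)

  ∈-allVecs : ∀ {A : Set} {xs : List A} → (∀ x → x ∈ xs) → ∀ {l} (v : Vec A l) → v ∈ allVecs xs l
  ∈-allVecs all Vec.[]      = here refl
  ∈-allVecs all (x Vec.∷ v) = ∈-concatMap⁺ _ (lose (all x) (∈-map⁺ (x Vec.∷_) (∈-allVecs all v)))

  -- Both sides branch on the first coordinate. Fixing it moves its adjacency conditions into the
  -- later candidate sets, from which they are recovered by splitting the conjunction in `nbr`.
  homs-≤-count : ∀ h (W : Fin h → Sub n) (R : Fin h → Fin h → Rel n) {P : Vec (Fin n) h → Set} (P? : Decidable P) →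
    (∀ φ → (∀ a → W a (Vec.lookup φ a) ≡ true) →
           (∀ a b → a Fin.< b → R a b (Vec.lookup φ a) (Vec.lookup φ b) ≡ true) → P φ) →
    homs h W R ≤ length (filter P? (allVecs (allFin n) h))
  homs-≤-count zero W R P? hom⇒P = filter-some P? (here (hom⇒P Vec.[] (λ ()) (λ ())))
  homs-≤-count {n} (suc h) W R P? hom⇒P = begin
    homs (suc h) W R
      ≤⟨ ∑-mono slice ⟩
    ∑[ v < n ] length (filter P? (map (v Vec.∷_) (allVecs (allFin n) h)))
      ≡⟨ length-filter-concatMap P? (λ v → map (v Vec.∷_) (allVecs (allFin n) h)) id ⟨
    length (filter P? (allVecs (allFin n) (suc h))) ∎
    where
    ⟦⟧*-≤ : ∀ b {x y} → (b ≡ true → x ≤ y) → ⟦ b ⟧ * x ≤ y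
    ⟦⟧*-≤ false _   = z≤n
    ⟦⟧*-≤ true  {x} x≤y = ≤-trans (≤-reflexive (*-identityˡ x)) (x≤y refl)
    slice : ∀ v → ⟦ W zero v ⟧ * homs h (λ j → nbr (R zero (suc j)) (W (suc j)) v) (λ a b → R (suc a) (suc b)) ≤
                  length (filter P? (map (v Vec.∷_) (allVecs (allFin n) h)))
    slice v = ⟦⟧*-≤ (W zero v) λ v∈W → ≤-trans
      (homs-≤-count h _ _ (P? ∘ (v Vec.∷_)) λ φ φ∈W φ-hom → hom⇒P (v Vec.∷ φ)
        (λ { zero → v∈W ; (suc a) → proj₁ (∧-true (φ∈W a)) })
        (λ { zero    (suc b) _         → proj₂ (∧-true {W (suc b) (Vec.lookup φ b)} (φ∈W b))
           ; (suc a) (suc b) (s<s a<b) → φ-hom a b a<b }))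
      (≤-reflexive (≡.sym (length-filter-map P? (v Vec.∷_) (allVecs (allFin n) h))))

  -- A vertex misses at most itself, and dropping one element from a set of at least two leaves at
  -- least half of it, enough for density 1/D. The bound `L < card B` rules out sets `Y` with fewer
  -- than two elements.
  Dense-≢ : ∀ {R : Rel n} {L D A B} → 2 ≤ D → L < card B → (∀ u v → u ≢ v → R u v ≡ true) → Dense R L D A B
  Dense-≢ {n} {R} {L} {D} {A} {B} 2≤D L<|B| full X Y _ _ _ |B|≤L|Y| = begin
    card X * card Y                             ≡⟨ *-distribʳ-sum (card Y) (λ u → ⟦ X u ⟧) ⟩
    ∑[ u < n ] (⟦ X u ⟧ * card Y)               ≤⟨ ∑-mono (λ u → ≤-trans (*-monoʳ-≤ ⟦ X u ⟧ (degree u))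
                                                     (≤-reflexive (x*[y*z] ⟦ X u ⟧ D _))) ⟩
    ∑[ u < n ] (D * (⟦ X u ⟧ * card (nbr R Y u))) ≡⟨ *-distribˡ-sum {n} D _ ⟨
    D * edges R X Y                                 ∎
    where
    x*[y*z] : ∀ x y z → x * (y * z) ≡ y * (x * z)
    x*[y*z] = solve 3 (λ x y z → x :* (y :* z) := y :* (x :* z)) refl
    2≤|Y| : 2 ≤ card Y
    2≤|Y| = ≰⇒> λ |Y|≤1 → <-irrefl refl (begin-strict
      L           <⟨ L<|B| ⟩
      card B      ≤⟨ |B|≤L|Y| ⟩
      L * card Y  ≤⟨ *-monoʳ-≤ L |Y|≤1 ⟩
      L * 1       ≡⟨ *-identityʳ L ⟩
      L           ∎)
    all-but-one : ∀ u → card Y ≤ 1 + card (nbr R Y u)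
    all-but-one u = begin
      card Y                                                    ≤⟨ ∑-mono pointwise ⟩
      ∑[ v < n ] (⟦ does (u ≟ v) ⟧ * 1 + ⟦ nbr R Y u v ⟧)       ≡⟨ ∑-distrib-+ {n} (λ v → ⟦ does (u ≟ v) ⟧ * 1) _ ⟩
      ∑[ v < n ] (⟦ does (u ≟ v) ⟧ * 1) + card (nbr R Y u)      ≡⟨ cong (_+ card (nbr R Y u)) (∑-point u (λ _ → 1)) ⟩
      1 + card (nbr R Y u)                                      ∎
      where
      pointwise : ∀ v → ⟦ Y v ⟧ ≤ ⟦ does (u ≟ v) ⟧ * 1 + ⟦ nbr R Y u v ⟧
      pointwise v with u ≟ v
      ... | yes _  = ≤-trans (⟦⟧≤1 (Y v)) (s≤s z≤n)
      ... | no u≢v rewrite full u v u≢v | Bool.∧-identityʳ (Y v) = ≤-refl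
    degree : ∀ u → card Y ≤ D * card (nbr R Y u)
    degree u = begin
      card Y              ≤⟨ all-but-one u ⟩
      1 + z               ≤⟨ +-monoˡ-≤ z (+-cancelˡ-≤ 1 1 z (≤-trans 2≤|Y| (all-but-one u))) ⟩
      z + z               ≡⟨ cong (z +_) (+-identityʳ z) ⟨
      2 * z               ≤⟨ *-monoˡ-≤ z 2≤D ⟩
      D * z               ∎
      where z = card (nbr R Y u)

  -- Deleting a region from every graph of a system.

  sumFin≤ : ∀ {k b} (f : Fin k → ℕ) → (∀ i → f i ≤ b) → sumFin f ≤ k * b
  sumFin≤ {zero}  f f≤b = z≤n
  sumFin≤ {suc k} f f≤b = +-mono-≤ (f≤b zero) (sumFin≤ (f ∘ suc) (f≤b ∘ suc))

  ⟦∨⟧≤ : ∀ a b → ⟦ a ∨ b ⟧ ≤ ⟦ a ⟧ + ⟦ b ⟧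
  ⟦∨⟧≤ true  b = s≤s z≤n
  ⟦∨⟧≤ false b = ≤-refl

  ∨-false : ∀ {a b} → a ∨ b ≡ false → a ≡ false × b ≡ false
  ∨-false {false} {false} _ = refl , refl

  from-does-false : ∀ {ℓ} {P : Set ℓ} (P? : Dec P) → does P? ≡ false → ¬ P
  from-does-false (no ¬p) _ = ¬p

  -- Both orientations are deleted, since `Z` may be asymmetric and the result must be a simple
  -- graph.
  delete : Rel n → SimpleGraph n → SimpleGraph n
  delete Z G = record
    { adj      = λ u v → adj G u v ∧ not (Z u v ∨ Z v u)
    ; sym      = λ u v → cong₂ _∧_ (SimpleGraph.sym G u v) (cong not (Bool.∨-comm (Z u v) (Z v u)))
    ; loopless = λ v → cong (_∧ _) (loopless G v)
    }

  delete-edge : (Z : Rel n) (G : SimpleGraph n) → ∀ {u v} → adj (delete Z G) u v ≡ true →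
                adj G u v ≡ true × Z u v ≡ false × Z v u ≡ false
  delete-edge Z G {u} {v} uv with adj G u v | Z u v | Z v u
  ... | true | false | false = refl , refl , refl

  -- A lost edge lies in `Z` or in its transpose, and the two have the same area; hence the factor
  -- 2.
  edgeCount-delete : (Z : Rel n) (G : SimpleGraph n) → edgeCount G ≤ edgeCount (delete Z G) + 2 * area Z
  edgeCount-delete {n} Z G = ≤-trans
    (length-filter-⊎ _ _ (λ (u , v) → (Z u v ∨ Z v u) Bool.≟ true) split (cartesianProduct (allFin n) (allFin n)))
    (+-monoʳ-≤ (edgeCount (delete Z G)) (begin
      length (filter (λ (u , v) → (Z u v ∨ Z v u) Bool.≟ true) (cartesianProduct (allFin n) (allFin n)))
        ≡⟨ length-filter-cartesianProduct (λ (u , v) → (Z u v ∨ Z v u) Bool.≟ true) id (allFin n) ⟩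
      ∑[ u < n ] length (filter (λ v → (Z u v ∨ Z v u) Bool.≟ true) (allFin n))
        ≡⟨ ∑-cong (λ u → length-filter-tabulate (λ v → (Z u v ∨ Z v u) Bool.≟ true) id) ⟩
      area (λ u v → does ((Z u v ∨ Z v u) Bool.≟ true))
        ≤⟨ area-∨ _ Z (λ u v → Z v u) (λ u v → ≤-trans
             (⟦⟧-mono {b = Z u v ∨ Z v u} (from-does ((Z u v ∨ Z v u) Bool.≟ true))) (⟦∨⟧≤ (Z u v) (Z v u))) ⟩
      area Z + area (λ u v → Z v u)
        ≡⟨ cong (area Z +_) (trans (∑-comm {n} {n} (λ u v → ⟦ Z v u ⟧)) (≡.sym (+-identityʳ _))) ⟩
      2 * area Z ∎))
    where
    split : ∀ {p : Fin n × Fin n} → proj₁ p Fin.< proj₂ p × adj G (proj₁ p) (proj₂ p) ≡ true →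
            (proj₁ p Fin.< proj₂ p × adj (delete Z G) (proj₁ p) (proj₂ p) ≡ true) ⊎
            (Z (proj₁ p) (proj₂ p) ∨ Z (proj₂ p) (proj₁ p) ≡ true)
    split {u , v} (u<v , uv) with Z u v ∨ Z v u
    ... | true  = inj₂ refl
    ... | false = inj₁ (u<v , trans (Bool.∧-identityʳ _) uv)

  deletedEdges-delete : ∀ {k n} (Z : Rel n) (𝒢 : GraphSystem k n) → deletedEdges 𝒢 (delete Z ∘ 𝒢) ≤ k * (2 * area Z)
  deletedEdges-delete Z 𝒢 = sumFin≤ _ λ i → m≤n+o⇒m∸n≤o _ (edgeCount (delete Z (𝒢 i))) (edgeCount-delete Z (𝒢 i))

  -- Cleaning with respect to a sparse–dense partition

  -- One parameter `U` controls three quantities: the density of the sparse regions, the area of the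
  -- irregular pairs and the size below which a cell is small. Each source of deletions then costs
  -- O(n²/U) for fixed `r`.
  module Clean {n r : ℕ} (R : Fin r → Rel n) (L U : ℕ) {m : ℕ} (part : Partition R L U m)
               (regular : U * Partition.irregularArea part ≤ n * n) where
    open Partition part

    small : Fin m → Bool
    small a = does (U * m * card (fibre P a) <? n)

    -- A sparse region may be large, so only the pairs of the relation are removed from it;
    -- irregular pairs of cells are few enough to be removed whole.
    hit : Fin r → Rel n
    hit x u v = (S x (P u) (P v) ∧ R x u v) ∨ irregular x (P u) (P v)

    hit? : ∀ u v → Dec (∃ λ x → hit x u v ≡ true)
    hit? u v = any? λ x → hit x u v Bool.≟ true

    removed : Rel n
    removed u v = small (P u) ∨ (small (P v) ∨ does (hit? u v))

    -- At most `m` cells are small, each with fewer than n/(U m) vertices.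
    few-small : U * ∑[ v < n ] ⟦ small (P v) ⟧ ≤ n
    few-small = begin
      U * ∑[ v < n ] ⟦ small (P v) ⟧                                ≡⟨ cong (U *_) (∑-fibres P (λ a _ → ⟦ small a ⟧)) ⟩
      U * ∑[ a < m ] ∑[ v < n ] (⟦ fibre P a v ⟧ * ⟦ small a ⟧)     ≡⟨ cong (U *_) (∑-cong λ a → *-distribʳ-sum ⟦ small a ⟧ (λ v → ⟦ fibre P a v ⟧)) ⟨
      U * ∑[ a < m ] (card (fibre P a) * ⟦ small a ⟧)               ≤⟨ average m _ (λ a → each (U * m * card (fibre P a) <? n)) ⟩
      n                                                             ∎
      where
      each : ∀ {x} (s : Dec (U * m * x < n)) → U * m * (x * ⟦ does s ⟧) ≤ n
      each {x} (yes lt) rewrite *-identityʳ x = <⇒≤ lt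
      each {x} (no _)   rewrite *-zeroʳ x | *-zeroʳ (U * m) = z≤n
      average : ∀ m (x : Fin m → ℕ) → (∀ a → U * m * x a ≤ n) → U * sum x ≤ n
      average zero      x _  = ≤-trans (≤-reflexive (*-zeroʳ U)) z≤n
      average m@(suc _) x le = *-cancelˡ-≤ m (begin
        m * (U * sum x)             ≡⟨ trans (≡.sym (*-assoc m U (sum x))) (cong (_* sum x) (*-comm m U)) ⟩
        U * m * sum x               ≡⟨ *-distribˡ-sum (U * m) x ⟩
        ∑[ a < m ] (U * m * x a)    ≤⟨ ∑-mono le ⟩
        ∑[ _ < m ] n                ≡⟨ ∑-const m n ⟩
        m * n                       ∎)

    small-rows : U * area (λ u v → small (P u)) ≤ n * n
    small-rows = begin
      U * ∑[ u < n ] ∑[ _ < n ] ⟦ small (P u) ⟧   ≡⟨ cong (U *_) (∑-cong λ u → ∑-const n ⟦ small (P u) ⟧) ⟩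
      U * ∑[ u < n ] (n * ⟦ small (P u) ⟧)        ≡⟨ cong (U *_) (*-distribˡ-sum {n} n _) ⟨
      U * (n * ∑[ u < n ] ⟦ small (P u) ⟧)        ≡⟨ solve 3 (λ x y z → x :* (y :* z) := y :* (x :* z)) refl U n _ ⟩
      n * (U * ∑[ u < n ] ⟦ small (P u) ⟧)        ≤⟨ *-monoʳ-≤ n few-small ⟩
      n * n                                       ∎

    small-columns : U * area (λ u v → small (P v)) ≤ n * n
    small-columns = ≤-trans (≤-reflexive (cong (U *_) (∑-comm {n} {n} (λ u v → ⟦ small (P v) ⟧)))) small-rows

    -- A union bound over the relations. Every sparse region may cost n², but `irregularArea` is
    -- already a sum over the relations and costs n² only once.
    few-hits : U * area (λ u v → does (hit? u v)) ≤ r * (n * n) + n * n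
    few-hits = begin
      U * area (λ u v → does (hit? u v))
        ≤⟨ *-monoʳ-≤ U (∑-mono λ u → ∑-mono λ v → union (hit? u v)) ⟩
      U * ∑[ u < n ] ∑[ v < n ] ∑[ x < r ] ⟦ hit x u v ⟧
        ≡⟨ cong (U *_) (∑-cong λ u → ∑-comm {n} {r} (λ v x → ⟦ hit x u v ⟧)) ⟩
      U * ∑[ u < n ] ∑[ x < r ] ∑[ v < n ] ⟦ hit x u v ⟧
        ≡⟨ cong (U *_) (∑-comm {n} {r} (λ u x → ∑[ v < n ] ⟦ hit x u v ⟧)) ⟩
      U * ∑[ x < r ] area (hit x)
        ≤⟨ *-monoʳ-≤ U (∑-mono λ x → area-∨ (hit x) (λ u v → S x (P u) (P v) ∧ R x u v) (λ u v → irregular x (P u) (P v))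
             λ u v → ⟦∨⟧≤ (S x (P u) (P v) ∧ R x u v) (irregular x (P u) (P v))) ⟩
      U * ∑[ x < r ] (area (λ u v → S x (P u) (P v) ∧ R x u v) + area (λ u v → irregular x (P u) (P v)))
        ≡⟨ cong (U *_) (∑-distrib-+ {r} (λ x → area (λ u v → S x (P u) (P v) ∧ R x u v)) _) ⟩
      U * (∑[ x < r ] area (λ u v → S x (P u) (P v) ∧ R x u v) + irregularArea)
        ≡⟨ *-distribˡ-+ U _ irregularArea ⟩
      U * ∑[ x < r ] area (λ u v → S x (P u) (P v) ∧ R x u v) + U * irregularArea
        ≡⟨ cong (_+ U * irregularArea) (*-distribˡ-sum {r} U _) ⟩
      ∑[ x < r ] (U * area (λ u v → S x (P u) (P v) ∧ R x u v)) + U * irregularArea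
        ≤⟨ +-mono-≤ (≤-trans (∑-mono sparse) sparseArea≤) regular ⟩
      r * (n * n) + n * n ∎
      where
      member : ∀ {r} (f : Fin r → ℕ) x → f x ≤ sum f
      member f zero    = m≤m+n _ _
      member f (suc x) = ≤-trans (member (f ∘ suc) x) (m≤n+m _ (f zero))
      union : ∀ {u v} (d : Dec (∃ λ x → hit x u v ≡ true)) → ⟦ does d ⟧ ≤ ∑[ x < r ] ⟦ hit x u v ⟧
      union (no _) = z≤n
      union {u} {v} (yes (x , eq)) = ≤-trans (≤-reflexive (cong ⟦_⟧ (≡.sym eq))) (member (λ x → ⟦ hit x u v ⟧) x)

    -- The 3 collects small rows, small columns and irregular pairs; `r` comes from the sparse
    -- regions.
    few-removed : U * area removed ≤ (3 + r) * (n * n)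
    few-removed = begin
      U * area removed
        ≤⟨ *-monoʳ-≤ U (≤-trans (area-∨ removed (λ u v → small (P u)) rest λ u v → ⟦∨⟧≤ (small (P u)) _)
                                (+-monoʳ-≤ _ (area-∨ rest (λ u v → small (P v)) _ λ u v → ⟦∨⟧≤ (small (P v)) _))) ⟩
      U * (area (λ u v → small (P u)) + (area (λ u v → small (P v)) + area (λ u v → does (hit? u v))))
        ≡⟨ trans (*-distribˡ-+ U _ _) (cong (U * area (λ u v → small (P u)) +_) (*-distribˡ-+ U _ _)) ⟩
      U * area (λ u v → small (P u)) + (U * area (λ u v → small (P v)) + U * area (λ u v → does (hit? u v)))
        ≤⟨ +-mono-≤ small-rows (+-mono-≤ small-columns few-hits) ⟩
      n * n + (n * n + (r * (n * n) + n * n))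
        ≡⟨ solve 2 (λ r x → x :+ (x :+ (r :* x :+ x)) := (con 3 :+ r) :* x) refl r (n * n) ⟩
      (3 + r) * (n * n) ∎
      where
      rest : Rel n
      rest u v = small (P v) ∨ does (hit? u v)

    kept⇒large : ∀ u v → removed u v ≡ false → n ≤ U * m * card (fibre P (P u)) × n ≤ U * m * card (fibre P (P v))
    kept⇒large u v kept = let ¬su , rest = ∨-false kept ; ¬sv , _ = ∨-false rest in
      ≮⇒≥ (from-does-false (_ <? _) ¬su) , ≮⇒≥ (from-does-false (_ <? _) ¬sv)

    -- A pair of the relation lying in its sparse region would have been removed, so the two cells
    -- are outside `S x`; they are not irregular either, and the search leaves only density.
    kept⇒dense : ∀ x u v → removed u v ≡ false → R x u v ≡ true → Dense (R x) L U (fibre P (P u)) (fibre P (P v))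
    kept⇒dense x u v kept uv =
      let _ , rest = ∨-false {small (P u)} kept
          _ , ¬hit = ∨-false {small (P v)} rest
          ¬S , ¬irr = ∨-false (Bool.¬-not (λ eq → from-does-false (hit? u v) ¬hit (x , eq)))
      in regular⇒dense x (P u) (P v)
           (trans (≡.sym (trans (cong (S x (P u) (P v) ∧_) uv) (Bool.∧-identityʳ _))) ¬S) ¬irr

  -- Surviving copies

  constrain : ∀ {Q : Set} → Dec Q → Sub n → Sub n
  constrain (yes _) X = X
  constrain (no _)  _ = λ _ → true

  constrain-yes : ∀ {Q : Set} (d : Dec Q) (X : Sub n) → Q → constrain d X ≡ X
  constrain-yes (yes _) X _ = refl
  constrain-yes (no ¬q) X q = contradiction q ¬q

  module _ {k : ℕ} (H : Multigraph) where

    Joins : Fin (nE H) → Fin (nV H) → Fin (nV H) → Set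
    Joins ε a b = ends H ε ≡ (a , b) ⊎ ends H ε ≡ (b , a)

    joins? : ∀ ε a b → Dec (Joins ε a b)
    joins? ε a b = ≡-dec _≟_ _≟_ (ends H ε) (a , b) ⊎-dec ≡-dec _≟_ _≟_ (ends H ε) (b , a)

    -- All colourings are included because the partition is chosen before the colouring of a
    -- surviving copy is known.
    Index : Set
    Index = Vec (Fin k) (nE H) × Fin (nV H) × Fin (nV H)

    indices : List Index
    indices = cartesianProduct (allVecs (allFin k) (nE H)) (cartesianProduct (allFin (nV H)) (allFin (nV H)))

    ∈-indices : ∀ i → i ∈ indices
    ∈-indices (c , a , b) = ∈-cartesianProduct⁺ (∈-allVecs ∈-allFin c) (∈-cartesianProduct⁺ (∈-allFin a) (∈-allFin b))

    -- If a and b are not adjacent in H, only u ≠ v remains.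
    Carries : GraphSystem k n → Index → Fin n → Fin n → Set
    Carries 𝒢 (c , a , b) u v = u ≢ v × (∀ ε → Joins ε a b → adj (𝒢 (Vec.lookup c ε)) u v ≡ true)

    carries? : ∀ (𝒢 : GraphSystem k n) i u v → Dec (Carries 𝒢 i u v)
    carries? 𝒢 (c , a , b) u v = ¬? (u ≟ v) ×-dec
      all? (λ ε → joins? ε a b →-dec (adj (𝒢 (Vec.lookup c ε)) u v Bool.≟ true))

    carrier : GraphSystem k n → Index → Rel n
    carrier 𝒢 i u v = does (carries? 𝒢 i u v)

    -- Injectivity comes from the clause `u ≢ v` of `Carries`, imposed on adjacent and nonadjacent
    -- pairs alike. The relations are given only for a < b; symmetry of the graphs handles edges
    -- stored in the other order.
    homomorphism⇒copy : ∀ (ψ : RainbowPrecoloring k H) (𝒢 : GraphSystem k n) c →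
      (∀ ε f → Vec.lookup c ε ≡ Vec.lookup c f → ε ≡ f) →
      (∀ ε j → RainbowPrecoloring.ψ ψ ε ≡ just j → Vec.lookup c ε ≡ j) →
      ∀ φ → (∀ a b → a Fin.< b → carrier 𝒢 (c , a , b) (Vec.lookup φ a) (Vec.lookup φ b) ≡ true) →
      IsRainbowCopy H ψ 𝒢 (φ , c)
    homomorphism⇒copy ψ 𝒢 c c-inj c-ext φ hom = φ-inj , c-inj , c-ext , edge
      where
      carried : ∀ a b → a Fin.< b → Carries 𝒢 (c , a , b) (Vec.lookup φ a) (Vec.lookup φ b)
      carried a b a<b = from-does (carries? 𝒢 (c , a , b) _ _) (hom a b a<b)
      φ-inj : ∀ a b → Vec.lookup φ a ≡ Vec.lookup φ b → a ≡ b
      φ-inj a b eq with <-cmp a b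
      ... | tri< a<b _ _ = contradiction eq (proj₁ (carried a b a<b))
      ... | tri≈ _ a≡b _ = a≡b
      ... | tri> _ _ b<a = contradiction (≡.sym eq) (proj₁ (carried b a b<a))
      edge : ∀ ε → adj (𝒢 (Vec.lookup c ε)) (Vec.lookup φ (proj₁ (ends H ε))) (Vec.lookup φ (proj₂ (ends H ε))) ≡ true
      edge ε with <-cmp (proj₁ (ends H ε)) (proj₂ (ends H ε))
      ... | tri< a<b _ _ = proj₂ (carried _ _ a<b) ε (inj₁ refl)
      ... | tri≈ _ a≡b _ = contradiction a≡b (noLoop H ε)
      ... | tri> _ _ b<a = trans (SimpleGraph.sym (𝒢 (Vec.lookup c ε)) _ _) (proj₂ (carried _ _ b<a) ε (inj₂ refl))

    -- If n ≤ U * M * threshold, a single copy already exceeds the allowance, by the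
    -- second summand; the third one comes from the counting lemma.
    bound : (U M : ℕ) → ℕ
    bound U M = 1 + (U * M * threshold U (nV H)) ^ nV H + (U * M) ^ nV H * loss U (nV H)

    module Survivor {n : ℕ} (ψ : RainbowPrecoloring k H) (𝒢 : GraphSystem k n) (U : ℕ) (2≤U : 2 ≤ U) where

      h r L : ℕ
      h = nV H
      r = length indices
      L = threshold U h

      R : Fin r → Rel n
      R = carrier 𝒢 ∘ List.lookup indices

      module _ {m : ℕ} (part : Partition R L U m) (regular : U * Partition.irregularArea part ≤ n * n) where
        open Clean R L U part regular
        open Partition part using (P)

        cleaned : GraphSystem k n
        cleaned = delete removed ∘ 𝒢

        module _ (φ : Vec (Fin n) h) (c : Vec (Fin k) (nE H)) (survives : IsRainbowCopy H ψ cleaned (φ , c)) where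

          φ′ : Fin h → Fin n
          φ′ = Vec.lookup φ

          φ-inj : ∀ a b → φ′ a ≡ φ′ b → a ≡ b
          φ-inj = proj₁ survives

          c-inj : ∀ ε f → Vec.lookup c ε ≡ Vec.lookup c f → ε ≡ f
          c-inj = proj₁ (proj₂ survives)

          c-ext : ∀ ε j → RainbowPrecoloring.ψ ψ ε ≡ just j → Vec.lookup c ε ≡ j
          c-ext = proj₁ (proj₂ (proj₂ survives))

          survives-edge : ∀ ε → adj (cleaned (Vec.lookup c ε)) (φ′ (proj₁ (ends H ε))) (φ′ (proj₂ (ends H ε))) ≡ true
          survives-edge = proj₂ (proj₂ (proj₂ survives))

          ends-at : ∀ {ε a b} → ends H ε ≡ (a , b) → adj (cleaned (Vec.lookup c ε)) (φ′ a) (φ′ b) ≡ true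
          ends-at {ε} eq = subst (λ (a , b) → adj (cleaned (Vec.lookup c ε)) (φ′ a) (φ′ b) ≡ true) eq (survives-edge ε)

          edge : ∀ {a b} ε → Joins ε a b →
                 adj (𝒢 (Vec.lookup c ε)) (φ′ a) (φ′ b) ≡ true × removed (φ′ a) (φ′ b) ≡ false
          edge ε (inj₁ eq) =
            let ab , kept , _ = delete-edge removed (𝒢 (Vec.lookup c ε)) (ends-at eq) in ab , kept
          edge ε (inj₂ eq) =
            let ba , _ , kept = delete-edge removed (𝒢 (Vec.lookup c ε)) (ends-at eq) in
            trans (SimpleGraph.sym (𝒢 (Vec.lookup c ε)) _ _) ba , kept

          original : IsRainbowCopy H ψ 𝒢 (φ , c)
          original = φ-inj , c-inj , c-ext , λ ε → proj₁ (edge ε (inj₁ refl))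

          copies : ℕ
          copies = rainbowCopyCount H ψ 𝒢

          1≤copies : 1 ≤ copies
          1≤copies = filter-some (isRainbowCopy? H ψ 𝒢)
            (lose (∈-cartesianProduct⁺ (∈-allVecs ∈-allFin φ) (∈-allVecs ∈-allFin c)) original)

          Incident : Fin h → Set
          Incident a = ∃ λ ε → ∃ λ b → Joins ε a b

          incident? : ∀ a → Dec (Incident a)
          incident? a = any? λ ε → any? λ b → joins? ε a b

          -- An isolated vertex of H may sit in a small cell, so it is left unconstrained.
          W : Fin h → Sub n
          W a = constrain (incident? a) (fibre P (P (φ′ a)))

          W-large : ∀ a → n ≤ U * m * card (W a)
          W-large a = go (incident? a)
            where
            go : (d : Dec (Incident a)) → n ≤ U * m * card (constrain d (fibre P (P (φ′ a))))
            go (yes (ε , b , j)) = proj₁ (kept⇒large (φ′ a) (φ′ b) (proj₂ (edge ε j)))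
            go (no _) = begin
              n                                   ≡⟨ *-identityʳ n ⟨
              n * 1                               ≡⟨ ∑-const n 1 ⟨
              -- The factor `m` is nonzero because `φ′ a` lies in some cell.
              card {n} (λ _ → true)               ≤⟨ m≤n*m (card {n} (λ _ → true)) (U * m) ⦃ m*n≢0 U m ⦃ >-nonZero (≤-trans (s≤s z≤n) 2≤U) ⦄ ⦃ nonZeroIndex (P (φ′ a)) ⦄ ⦄ ⟩
              U * m * card {n} (λ _ → true)       ∎

          -- One joining edge suffices: the surviving copy realises all parallel edges in their
          -- colours, and the absence of loops together with injectivity of `φ` separates the
          -- images.
          carried : ∀ {a b} ε → Joins ε a b → carrier 𝒢 (c , a , b) (φ′ a) (φ′ b) ≡ true
          carried {a} {b} ε j = dec-true (carries? 𝒢 (c , a , b) (φ′ a) (φ′ b))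
            (distinct , λ f j′ → proj₁ (edge f j′))
            where
            distinct : φ′ a ≢ φ′ b
            distinct eq with refl ← φ-inj a b eq =
              [ (λ ends≡ → noLoop H ε (trans (cong proj₁ ends≡) (≡.sym (cong proj₂ ends≡))))
              , (λ ends≡ → noLoop H ε (trans (cong proj₁ ends≡) (≡.sym (cong proj₂ ends≡)))) ]′ j

          -- A joined pair inherits density from its surviving edge. For any other pair `Dense-≢`
          -- applies, and the size of `n` enters there: U m L < n ≤ U m |W b| gives L < |W b|.
          W-dense : U * m * L < n → ∀ a b → Dense (carrier 𝒢 (c , a , b)) L U (W a) (W b)
          W-dense n-large a b = go (any? (λ ε → joins? ε a b))
            where
            x : Fin r
            x = Any.index (∈-indices (c , a , b))
            found : (c , a , b) ≡ List.lookup indices x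
            found = lookup-index (∈-indices (c , a , b))
            go : Dec (∃ λ ε → Joins ε a b) → Dense (carrier 𝒢 (c , a , b)) L U (W a) (W b)
            go (yes (ε , j)) = ≡.subst₂ (Dense (carrier 𝒢 (c , a , b)) L U)
              (≡.sym (constrain-yes (incident? a) (fibre P (P (φ′ a))) (ε , b , j)))
              (≡.sym (constrain-yes (incident? b) (fibre P (P (φ′ b))) (ε , a , swap j)))
              (subst (λ i → Dense (carrier 𝒢 i) L U (fibre P (P (φ′ a))) (fibre P (P (φ′ b)))) (≡.sym found)
                (kept⇒dense x (φ′ a) (φ′ b) (proj₂ (edge ε j))
                  (subst (λ i → carrier 𝒢 i (φ′ a) (φ′ b) ≡ true) found (carried ε j))))
            go (no ¬j) = Dense-≢ 2≤U
              (*-cancelˡ-< (U * m) L (card (W b)) (<-≤-trans n-large (W-large b)))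
              λ u v u≢v → dec-true (carries? 𝒢 (c , a , b) u v) (u≢v , λ ε j → contradiction (ε , j) ¬j)

          -- Copies with the colouring `c` of the survivor are already numerous enough.
          many-copies : U * m * L < n → n ^ h ≤ (U * m) ^ h * (loss U h * copies)
          many-copies n-large = begin
            n ^ h                                     ≡⟨ prod-const h n ⟨
            prod {h} (λ _ → n)                        ≤⟨ prod-mono-scaled (U * m) W-large ⟩
            (U * m) ^ h * prod (card ∘ W)             ≤⟨ *-monoʳ-≤ ((U * m) ^ h) (begin
              prod (card ∘ W)                           ≤⟨ counting U h W Rc (λ a b _ → W-dense n-large a b) ⟩
              loss U h * homs h W Rc                    ≤⟨ *-monoʳ-≤ (loss U h) (begin
                homs h W Rc                               ≤⟨ homs-≤-count h W Rc (λ φ → isRainbowCopy? H ψ 𝒢 (φ , c))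
                                                               (λ φ _ → homomorphism⇒copy ψ 𝒢 c c-inj c-ext φ) ⟩
                length (filter (λ φ → isRainbowCopy? H ψ 𝒢 (φ , c)) (allVecs (allFin n) h))
                                                          ≤⟨ length-filter-slice (isRainbowCopy? H ψ 𝒢) (allVecs (allFin n) h) (∈-allVecs ∈-allFin c) ⟩
                copies                                    ∎) ⟩
              loss U h * copies                         ∎) ⟩
            (U * m) ^ h * (loss U h * copies)         ∎
            where
            Rc : Fin h → Fin h → Rel n
            Rc a b = carrier 𝒢 (c , a , b)

          too-many-copies : ∀ {M} → m ≤ M → n ^ h < bound U M * copies
          too-many-copies {M} m≤M = [ few-vertices , many-vertices ]′ (≤-<-connex n (U * M * L))
            where
            small-n large-n : ℕ
            small-n = (U * M * L) ^ h
            large-n = (U * M) ^ h * loss U h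
            few-vertices : n ≤ U * M * L → n ^ h < bound U M * copies
            few-vertices n-small = begin-strict
              n ^ h               ≤⟨ ^-monoˡ-≤ h n-small ⟩
              small-n             <⟨ n<1+n small-n ⟩
              1 + small-n         ≤⟨ m≤m+n (1 + small-n) large-n ⟩
              bound U M           ≤⟨ m≤m*n (bound U M) copies ⦃ >-nonZero 1≤copies ⦄ ⟩
              bound U M * copies  ∎
            many-vertices : U * M * L < n → n ^ h < bound U M * copies
            many-vertices n-large = begin-strict
              n ^ h                              ≤⟨ many-copies (≤-<-trans (*-monoˡ-≤ L (*-monoʳ-≤ U m≤M)) n-large) ⟩
              (U * m) ^ h * (loss U h * copies)  ≡⟨ *-assoc ((U * m) ^ h) (loss U h) copies ⟨
              (U * m) ^ h * loss U h * copies    ≤⟨ *-monoˡ-≤ copies (*-monoˡ-≤ (loss U h) (^-monoˡ-≤ h (*-monoʳ-≤ U m≤M))) ⟩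
              large-n * copies                   <⟨ *-monoˡ-< copies ⦃ >-nonZero 1≤copies ⦄ (s≤s (m≤n+m large-n small-n)) ⟩
              bound U M * copies                 ∎

        few-deleted : U * deletedEdges 𝒢 cleaned ≤ (3 + r) * (2 * k) * (n * n)
        few-deleted = begin
          U * deletedEdges 𝒢 cleaned      ≤⟨ *-monoʳ-≤ U (deletedEdges-delete removed 𝒢) ⟩
          U * (k * (2 * area removed))
            ≡⟨ solve 3 (λ u k a → u :* (k :* (con 2 :* a)) := con 2 :* k :* (u :* a)) refl U k (area removed) ⟩
          2 * k * (U * area removed)      ≤⟨ *-monoʳ-≤ (2 * k) few-removed ⟩
          2 * k * ((3 + r) * (n * n))
            ≡⟨ trans (≡.sym (*-assoc (2 * k) (3 + r) (n * n))) (cong (_* (n * n)) (*-comm (2 * k) (3 + r))) ⟩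
          (3 + r) * (2 * k) * (n * n)     ∎

    -- `regularity` supplies `M`, and thereby `K`, before the graph system is given. A copy
    -- surviving the cleaning would then contradict the assumed bound on the number of copies.
    removal-scaled : (ψ : RainbowPrecoloring k H) (U : ℕ) → 2 ≤ U → ∃ λ K → ∀ {n} (𝒢 : GraphSystem k n) →
      suc K * rainbowCopyCount H ψ 𝒢 ≤ n ^ nV H →
      ∃ λ 𝒢′ → (∀ i → 𝒢′ i ⊆G 𝒢 i) × U * deletedEdges 𝒢 𝒢′ ≤ (3 + length indices) * (2 * k) * (n * n) ×
               RainbowFree H ψ 𝒢′
    removal-scaled ψ U 2≤U = let M , regularised = regularity (length indices) (threshold U (nV H)) U U in
      -- Since `bound U M` begins with `1 +`, the successor of this witness computes to `bound U M`.
      pred (bound U M) , λ 𝒢 few →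
      let module 𝒮 = Survivor ψ 𝒢 U 2≤U
          m , m≤M , part , regular = regularised 𝒮.R
      in 𝒮.cleaned part regular
       , (λ i u v → proj₁ ∘ ∧-true)
       , 𝒮.few-deleted part regular
       , λ (φ , c) survives → <⇒≱ (𝒮.too-many-copies part regular φ c survives m≤M) few

    removal : (ψ : RainbowPrecoloring k H) (N : ℕ) → ∃ λ K → ∀ {n} (𝒢 : GraphSystem k n) →
      suc K * rainbowCopyCount H ψ 𝒢 ≤ n ^ nV H →
      ∃ λ 𝒢′ → (∀ i → 𝒢′ i ⊆G 𝒢 i) × N * deletedEdges 𝒢 𝒢′ ≤ n ^ 2 × RainbowFree H ψ 𝒢′
    -- The leading 2 secures `2 ≤ U`; the product absorbs the constant of `few-deleted` and leaves
    -- `N`. Writing `suc k` keeps the factor cancelled in `rescale` visibly nonzero.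
    removal ψ N = let K , remove = removal-scaled ψ (2 + (3 + length indices) * (2 * suc k) * N) (m≤m+n 2 _) in
      K , λ {n} 𝒢 few → let 𝒢′ , 𝒢′⊆𝒢 , deleted , free = remove 𝒢 few in
      𝒢′ , 𝒢′⊆𝒢 , rescale (length indices) (deletedEdges 𝒢 𝒢′) n deleted , free
      where
      rescale : ∀ r d n → (2 + (3 + r) * (2 * suc k) * N) * d ≤ (3 + r) * (2 * k) * (n * n) → N * d ≤ n ^ 2
      rescale r d n le = *-cancelˡ-≤ ((3 + r) * (2 * suc k)) (begin
        (3 + r) * (2 * suc k) * (N * d)            ≡⟨ *-assoc ((3 + r) * (2 * suc k)) N d ⟨
        (3 + r) * (2 * suc k) * N * d              ≤⟨ *-monoˡ-≤ d (m≤n+m ((3 + r) * (2 * suc k) * N) 2) ⟩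
        (2 + (3 + r) * (2 * suc k) * N) * d        ≤⟨ le ⟩
        (3 + r) * (2 * k) * (n * n)                ≤⟨ *-monoˡ-≤ (n * n) (*-monoʳ-≤ (3 + r) (*-monoʳ-≤ 2 (n≤1+n k))) ⟩
        (3 + r) * (2 * suc k) * (n * n)            ≡⟨ cong (λ x → (3 + r) * (2 * suc k) * (n * x)) (*-identityʳ n) ⟨
        (3 + r) * (2 * suc k) * n ^ 2              ∎)

-- From rational bounds to inequalities of natural numbers and back.

module Rationals where

  open import Data.Nat as ℕ using (ℕ; suc)
  import Data.Nat.Properties as ℕ
  open import Data.Nat.Coprimality using (1-coprimeTo)
  open import Data.Integer as ℤ using (+_)
  import Data.Integer.Properties as ℤ
  open import Data.Rational as ℚ using (ℚ; mkℚ; Positive; _≤_; _*_; _/_; toℚᵘ)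
  open import Data.Rational.Properties using (toℚᵘ-mono-≤; toℚᵘ-cancel-≤; toℚᵘ-homo-*; toℚᵘ-fromℚᵘ)
  open import Data.Rational.Unnormalised as ℚᵘ using (mkℚᵘ; *≤*)
  import Data.Rational.Unnormalised.Properties as ℚᵘ
  open import Relation.Binary.PropositionalEquality as ≡ using (trans; cong; subst₂)

  toℚᵘ-ℕ : ∀ a → toℚᵘ ((+ a) / 1) ℚᵘ.≃ mkℚᵘ (+ a) 0
  toℚᵘ-ℕ a = toℚᵘ-fromℚᵘ (mkℚᵘ (+ a) 0)

  toℚᵘ-*-ℕ : ∀ p b → toℚᵘ (p * ((+ b) / 1)) ℚᵘ.≃ toℚᵘ p ℚᵘ.* mkℚᵘ (+ b) 0
  toℚᵘ-*-ℕ p b = ℚᵘ.≃-trans (toℚᵘ-homo-* p ((+ b) / 1)) (ℚᵘ.*-congˡ {toℚᵘ p} (toℚᵘ-ℕ b))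

  1/1+_ : ℕ → ℚ
  1/1+ K = mkℚ (+ 1) K (1-coprimeTo (suc K))

  ≤-1/1+⇒*-≤ : ∀ K {a b} → (+ a) / 1 ≤ 1/1+ K * ((+ b) / 1) → suc K ℕ.* a ℕ.≤ b
  ≤-1/1+⇒*-≤ K {a} {b} le = ℤ.drop‿+≤+ (subst₂ ℤ._≤_
    (trans (≡.sym (ℤ.pos-* a (suc K ℕ.* 1))) (cong +_ (trans (cong (a ℕ.*_) (ℕ.*-identityʳ (suc K))) (ℕ.*-comm a (suc K)))))
    (trans (ℤ.*-identityʳ _) (ℤ.*-identityˡ (+ b)))
    (ℚᵘ.drop-*≤* (ℚᵘ.≤-respʳ-≃ (toℚᵘ-*-ℕ (1/1+ K) b) (ℚᵘ.≤-respˡ-≃ (toℚᵘ-ℕ a) (toℚᵘ-mono-≤ le)))))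

  -- A positive rational has numerator at least 1, so it is at least the reciprocal of its
  -- denominator; this lets the denominator of `ε` serve as `N` in `removal`.
  denominator*≤⇒≤ : ∀ ε → Positive ε → ∀ {a b} → ℚ.↧ₙ ε ℕ.* a ℕ.≤ b → (+ a) / 1 ≤ ε * ((+ b) / 1)
  denominator*≤⇒≤ ε@(mkℚ (+ suc p) d-1 _) _ {a} {b} le = toℚᵘ-cancel-≤
    (ℚᵘ.≤-respʳ-≃ (ℚᵘ.≃-sym (toℚᵘ-*-ℕ ε b)) (ℚᵘ.≤-respˡ-≃ (ℚᵘ.≃-sym (toℚᵘ-ℕ a)) (*≤* (subst₂ ℤ._≤_
      (trans (cong +_ (trans (ℕ.*-comm (suc d-1) a) (cong (a ℕ.*_) (≡.sym (ℕ.*-identityʳ (suc d-1)))))) (ℤ.pos-* a (suc d-1 ℕ.* 1)))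
      (trans (ℤ.pos-* (suc p) b) (≡.sym (ℤ.*-identityʳ _)))
      (ℤ.+≤+ (ℕ.≤-trans le (ℕ.m≤n*m b (suc p))))))))

open import Data.Nat using (ℕ; _≥_; _^_)
open import Data.Integer using (+_)
open import Data.Rational using (ℚ; Positive; _≤_; _*_; _/_; ↧ₙ_)
open import Data.Product using (Σ; _×_; _,_)
open Rationals

theorem4p2 : (k : ℕ) → k ≥ 1 → (H : Multigraph) → (ψ : RainbowPrecoloring k H) →
    (ε : ℚ) → Positive ε →
    Σ ℚ (λ δ → Positive δ ×
    ((n : ℕ) (𝒢 : GraphSystem k n) →
    (+ rainbowCopyCount H ψ 𝒢) / 1 ≤ δ * ((+ (n ^ nV H)) / 1) →
    Σ (GraphSystem k n) (λ 𝒢' →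
    ((i : _) → 𝒢' i ⊆G 𝒢 i) ×
    ((+ deletedEdges 𝒢 𝒢') / 1 ≤ ε * ((+ (n ^ 2)) / 1)) ×
    RainbowFree H ψ 𝒢')))
theorem4p2 k _ H ψ ε ε>0 =
  let K , remove = Removal.removal H ψ (↧ₙ ε) in
  1/1+ K , _ , λ n 𝒢 few →
    let 𝒢′ , 𝒢′⊆𝒢 , deleted , free = remove 𝒢 (≤-1/1+⇒*-≤ K few) in
    𝒢′ , 𝒢′⊆𝒢 , denominator*≤⇒≤ ε ε>0 deleted , free
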